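{- Let $\mathbb{K}$ be an associative ring with unity (not necessarily commutative), let $p,q$ be positive integers, let $P=[p]\times[q]$ be the $p\times q$-rectangle, let $f\in\mathbb{K}^{\widehat{P}}$ be a $\mathbb{K}$-labeling of $P$, and set $a=f(0)$. Let $u=(k,q)$ and $u'=(k-1,q)$ for some $k\in\{2,3,\ldots,p\}$, and let $d=(i,1)$ and $d'=(i-1,1)$ for some $i\in\{2,3,\ldots,p\}$. Assume that $a$ is invertible. Let $\ell\geq 1$ be an integer such that $R^{\ell+1}f\neq\bot$, where $R$ is birational rowmotion of $P$. Then $$A_{\ell}^{u\to d}=V_{\ell}^{u'\to d'},$$ where $A_\ell^{u\to d}$ and $V_\ell^{u'\to d'}$ are the path sums of down-slacks and up-slacks, respectively, of the labeling $R^\ell f$ (defined in the context).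
   Context: $\mathbb{K}$ is a fixed associative ring with unity, not necessarily commutative. An element is invertible if it has a two-sided inverse $x^{ -1}$. $\mathbb{N}=\{0,1,2,\ldots\}$. Extended poset. For a finite poset $P$, $\widehat{P}$ is the poset on the disjoint union $P\sqcup\{0,1\}$ in which $u\le v$ iff ($u,v\in P$ and $u\le v$ in $P$) or $u=0$ or $v=1$. Write $u\lessdot v$ (equivalently $v\gtrdot u$) if $u<v$ and no $w$ satisfies $u<w<v$ (in $\widehat{P}$). Labelings and partial maps. A $\mathbb{K}$-labeling of $P$ is a map $f:\widehat{P}\to\mathbb{K}$; the set of these is $\mathbb{K}^{\widehat{P}}$. A partial map $F:X\dashrightarrow Y$ is a map $X\to Y\sqcup\{\bot\}$, where $\bot$ means "undefined"; it is extended by $F(\bot)=\bot$, and partial maps are composed accordingly. Toggles. For $v\in P$, the toggle $T_v:\mathbb{K}^{\widehat{P}}\dashrightarrow\mathbb{K}^{\widehat{P}}$ is defined by $(T_vf)(w)=f(w)$ for $w\ne v$ and $$(T_vf)(v)=\Big(\sum_{u\in\widehat{P},\,u\lessdot v}f(u)\Big)\cdot f(v)^{ -1}\cdot\Big(\sum_{u\in\widehat{P},\,u\gtrdot v}f(u)^{ -1}\Big)^{ -1};$$ if any inverse in this formula does not exist, then $T_vf:=\bot$. Birational rowmotion. $R:=T_{v_1}\circ T_{v_2}\circ\cdots\circ T_{v_m}:\mathbb{K}^{\widehat{P}}\dashrightarrow\mathbb{K}^{\widehat{P}}$, where $(v_1,\ldots,v_m)$ is any linear extension of $P$ (a list of all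 elements of $P$, each exactly once, such that $v_i<v_j$ implies $i<j$); so the toggles at larger elements are applied first. This partial map does not depend on the choice of linear extension. $R^k$ is the $k$-fold composition, $R^0=\mathrm{id}$. Rectangle. For positive integers $p,q$, the $p\times q$-rectangle is $[p]\times[q]$ with $[n]=\{1,\ldots,n\}$ and order $(i,j)\le(i',j')$ iff $i\le i'$ and $j\le j'$. Slacks and path sums. For $x\in\widehat{P}$ and $\ell\in\mathbb{N}$ with $R^\ell f\ne\bot$, write $x_\ell:=(R^\ell f)(x)$. For $v\in P$ set $$A_\ell^v:=v_\ell\cdot\Big(\sum_{u\in\widehat{P},\,u\lessdot v}u_\ell\Big)^{ -1},\qquad V_\ell^v:=\Big(\sum_{u\in\widehat{P},\,u\gtrdot v}(u_\ell)^{ -1}\Big)^{ -1}\cdot (v_\ell)^{ -1},$$ and for $v\in\{0,1\}$ set $A_\ell^v:=V_\ell^v:=1$. A path from $s$ to $t$ ($s,t\in\widehat{P}$) is a sequence $(v_0,v_1,\ldots,v_k)$ of elements of $\widehat{P}$ with $k\geq 0$, $v_0=s$, $v_k=t$ and $v_0\gtrdot v_1\gtrdot\cdots\gtrdot v_k$. For such a path $\mathbf{p}$ set $A_\ell^{\mathbf{p}}:=A_\ell^{v_0}A_\ell^{v_1}\cdots A_\ell^{v_k}$ and $V_\ell^{\mathbf{p}}:=V_\ell^{v_0}V_\ell^{v_1}\cdots V_\ell^{v_k}$. Finally $A_\ell^{s\to t}:=\sum_{\mathbf{p}}A_\ell^{\mathbf{p}}$ and $V_\ell^{s\to t}:=\sum_{\mathbf{p}}V_\ell^{\mathbf{p}}$,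 the sums being over all paths $\mathbf{p}$ from $s$ to $t$ (empty sums are $0$). Under the hypotheses of the claim all the slacks occurring are well-defined. -}

module Defs where

open import Level using (Level; 0ℓ; _⊔_) renaming (suc to lsuc)
open import Algebra.Bundles using (Ring)
import Algebra.Definitions as AlgebraDefinitions
open import Data.Bool.Base using (if_then_else_)
open import Data.Fin.Base as Fin using (Fin)
import Data.Fin.Properties as Finₚ
open import Data.List.Base
  using (List; []; _∷_; [_]; _++_; map; foldr; filter; concatMap; length; lookup; allFin; cartesianProduct)
open import Data.List.Membership.Propositional using (_∈_; find; lose)
open import Data.List.Membership.Propositional.Properties
  using (∈-map⁺; ∈-map⁻; ∈-filter⁺; ∈-filter⁻; ∈-++⁺ˡ; ∈-++⁺ʳ; ∈-++⁻; ∈-concatMap⁺; ∈-concatMap⁻;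
         ∈-allFin; ∈-cartesianProduct⁺; ∈-lookup)
open import Data.List.Properties using (∷-injectiveʳ)
open import Data.List.Relation.Unary.All as All using (All; []; _∷_)
import Data.List.Relation.Unary.All.Properties as Allₚ
open import Data.List.Relation.Unary.AllPairs as AllPairs using ([]; _∷_)
import Data.List.Relation.Unary.AllPairs.Properties as AllPairsₚ
open import Data.List.Relation.Unary.Any using (here; there; any?; satisfied; index)
import Data.List.Relation.Unary.Any.Properties as Anyₚ
open import Data.List.Relation.Unary.Unique.Propositional using (Unique)
import Data.List.Relation.Unary.Unique.Propositional.Properties as Uniqueₚ
open import Data.Nat.Base as ℕ using (ℕ; zero; suc; s≤s)
import Data.Nat.Properties as ℕₚ
open import Data.Product.Base using (Σ-syntax; ∃-syntax; _×_; _,_; proj₁; proj₂)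
open import Data.Product.Properties using (≡-dec)
open import Data.Product.Relation.Binary.Pointwise.NonDependent using (Pointwise)
open import Data.Sum.Base using (inj₁; inj₂)
open import Data.Unit.Polymorphic.Base using (⊤)
open import Function.Base using (_∘_)
open import Function.Bundles using (_⇔_; mk⇔)
open import Relation.Binary.Core using (Rel)
open import Relation.Binary.Definitions using (Decidable)
open import Relation.Binary.PropositionalEquality
  using (_≡_; refl; sym; trans; cong; cong₂; isEquivalence)
open import Relation.Binary.Structures using (IsDecPartialOrder)
import Relation.Binary.Construct.NonStrictToStrict as ToStrict
import Relation.Binary.Construct.Add.Extrema.NonStrict as AddExtrema
open import Relation.Nullary.Construct.Add.Extrema using (_±; ⊥±; ⊤±)
  renaming ([_] to ⟦_⟧; [_]-injective to ⟦⟧-injective)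
open import Relation.Nullary.Decidable using (yes; no; does; map′; ¬?; _×-dec_)
open import Relation.Nullary.Negation using (¬_; contradiction)

------------------------------------------------------------------------
-- Partial maps

-- A partial element carries its domain of definition as a proposition,
-- since invertibility in an arbitrary ring is not decidable; ⊥ is the
-- case in which `Defined` is empty.

record Partial {x} (d : Level) (X : Set x) : Set (x ⊔ lsuc d) where
  field
    Defined : Set d
    value   : Defined → X

open Partial public

module _ {d : Level} where

  pure : ∀ {x} {X : Set x} → X → Partial d X
  pure x = record { Defined = ⊤ ; value = λ _ → x }

  infixl 1 _>>=_

  _>>=_ : ∀ {x y} {X : Set x} {Y : Set y} → Partial d X → (X → Partial d Y) → Partial d Y
  x >>= f = record
    { Defined = Σ[ dx ∈ Defined x ] Defined (f (value x dx))
    ; value   = λ (dx , dy) → value (f (value x dx)) dy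
    }

  -- Defined when every entry is.
  mapPartial : ∀ {y} {X : Set} {Y : Set y} → (X → Partial d Y) → List X → Partial d (List Y)
  mapPartial f xs = record
    { Defined = All (Defined ∘ f) xs
    ; value   = All.reduce (λ {x} → value (f x))
    }

  infixr 9 _∘ₚ_

  _∘ₚ_ : ∀ {x y z} {X : Set x} {Y : Set y} {Z : Set z} →
         (Y → Partial d Z) → (X → Partial d Y) → X → Partial d Z
  (F ∘ₚ G) x = G x >>= F

  iterate : ∀ {x} {X : Set x} → (X → Partial d X) → ℕ → X → Partial d X
  iterate F zero    = pure
  iterate F (suc k) = F ∘ₚ iterate F k

------------------------------------------------------------------------
-- Finite posets

record FinitePoset : Set₁ where
  field
    Carrier           : Set
    _≤_               : Rel Carrier 0ℓ
    isDecPartialOrder : IsDecPartialOrder _≡_ _≤_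
    elements          : List Carrier
    complete          : ∀ v → v ∈ elements
    unique            : Unique elements

  open ToStrict _≡_ _≤_ public using (_<_)
  open IsDecPartialOrder isDecPartialOrder public using (_≟_; _≤?_)

module Extended (P : FinitePoset) where
  private
    module P = FinitePoset P

  P̂ : Set
  P̂ = P.Carrier ±

  open AddExtrema P._≤_ public using () renaming (_≤±_ to _≤̂_)
  open ToStrict _≡_ _≤̂_ public using () renaming (_<_ to _<̂_)

  isDecPartialOrder-P̂ : IsDecPartialOrder _≡_ _≤̂_
  isDecPartialOrder-P̂ = AddExtrema.≤±-isDecPartialOrder-≡ P._≤_ P.isDecPartialOrder

  private
    module O = IsDecPartialOrder isDecPartialOrder-P̂

  infix 4 _≟̂_ _<̂?_ _⋖_ _⋖?_

  _≟̂_ : Decidable {A = P̂} _≡_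
  _≟̂_ = O._≟_

  _<̂?_ : Decidable _<̂_
  _<̂?_ = ToStrict.<-decidable _≡_ _≤̂_ O._≟_ O._≤?_

  elements-P̂ : List P̂
  elements-P̂ = ⊥± ∷ ⊤± ∷ map ⟦_⟧ P.elements

  complete-P̂ : ∀ u → u ∈ elements-P̂
  complete-P̂ ⊥±     = here refl
  complete-P̂ ⊤±     = there (here refl)
  complete-P̂ ⟦ v ⟧ = there (there (∈-map⁺ ⟦_⟧ (P.complete v)))

  unique-P̂ : Unique elements-P̂
  unique-P̂ =
    ((λ ()) ∷ Allₚ.map⁺ (All.universal (λ _ ()) P.elements)) ∷
    Allₚ.map⁺ (All.universal (λ _ ()) P.elements) ∷
    Uniqueₚ.map⁺ ⟦⟧-injective P.unique

  _⋖_ : Rel P̂ 0ℓ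
  u ⋖ v = u <̂ v × ¬ (∃[ w ] u <̂ w × w <̂ v)

  _⋖?_ : Decidable _⋖_
  u ⋖? v = u <̂? v ×-dec ¬? (map′ satisfied (λ (w , p) → lose (complete-P̂ w) p)
                              (any? (λ w → u <̂? w ×-dec w <̂? v) elements-P̂))

  lowerCovers upperCovers : P̂ → List P̂
  lowerCovers v = filter (_⋖? v) elements-P̂
  upperCovers v = filter (v ⋖?_) elements-P̂

  data IsPath : P̂ → P̂ → List P̂ → Set where
    stop : ∀ {t} → IsPath t t [ t ]
    step : ∀ {s u t p} → u ⋖ s → IsPath u t p → IsPath s t (s ∷ p)

  -- The paths from s to t with at most n vertices.
  pathsUpTo : ℕ → P̂ → P̂ → List (List P̂)
  pathsUpTo zero    s t = []
  pathsUpTo (suc n) s t =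
    (if does (s ≟̂ t) then [ [ t ] ] else []) ++
    map (s ∷_) (concatMap (λ u → pathsUpTo n u t) (lowerCovers s))

  -- No path has more vertices than P̂ has elements, so this bound loses
  -- nothing: see ∈-paths and paths-unique.
  paths : P̂ → P̂ → List (List P̂)
  paths = pathsUpTo (length elements-P̂)

  private
    ∈-pathsUpTo⁻ : ∀ n {s t p} → p ∈ pathsUpTo n s t → IsPath s t p
    ∈-pathsUpTo⁻ (suc n) {s} {t} p∈
      with ∈-++⁻ (if does (s ≟̂ t) then [ [ t ] ] else []) p∈
    ... | inj₁ q∈ with s ≟̂ t
    ...   | yes refl with q∈
    ...     | here refl = stop
    ∈-pathsUpTo⁻ (suc n) {s} {t} p∈ | inj₂ q∈
      with ∈-map⁻ (s ∷_) q∈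
    ... | q , q∈′ , refl
      with u , u∈ , r ← find (∈-concatMap⁻ (λ u → pathsUpTo n u t) {xs = lowerCovers s} q∈′)
      = step (proj₂ (∈-filter⁻ (_⋖? s) {xs = elements-P̂} u∈)) (∈-pathsUpTo⁻ n r)

    ∈-pathsUpTo⁺ : ∀ n {s t p} → length p ℕ.≤ n → IsPath s t p → p ∈ pathsUpTo n s t
    ∈-pathsUpTo⁺ (suc n) {s} _ stop with s ≟̂ s
    ... | yes _  = here refl
    ... | no s≢s = contradiction refl s≢s
    ∈-pathsUpTo⁺ (suc n) {s} {t} (s≤s p≤n) (step {u = u} u⋖s path) =
      ∈-++⁺ʳ (if does (s ≟̂ t) then [ [ t ] ] else [])
        (∈-map⁺ (s ∷_) (∈-concatMap⁺ (λ u → pathsUpTo n u t)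
          (lose (∈-filter⁺ (_⋖? s) (complete-P̂ u) u⋖s) (∈-pathsUpTo⁺ n p≤n path))))

    <̂-trans : ∀ {u v w} → u <̂ v → v <̂ w → u <̂ w
    <̂-trans = ToStrict.<-trans _≡_ _≤̂_ O.isPartialOrder

    head-max : ∀ {s t p} → IsPath s t p → ∀ {v} → s <̂ v → All (_<̂ v) p
    head-max stop           s<v = s<v ∷ []
    head-max (step u⋖s path) s<v = s<v ∷ head-max path (<̂-trans (proj₁ u⋖s) s<v)

    path-unique : ∀ {s t p} → IsPath s t p → Unique p
    path-unique stop            = [] ∷ []
    path-unique (step u⋖s path) =
      All.map (λ w<s s≡w → proj₂ w<s (sym s≡w)) (head-max path (proj₁ u⋖s)) ∷ path-unique path

    lookup-inj : ∀ {xs : List P̂} → Unique xs → ∀ i j → lookup xs i ≡ lookup xs j → i ≡ j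
    lookup-inj (_  ∷ _)  Fin.zero    Fin.zero    _  = refl
    lookup-inj (x∉ ∷ _)  Fin.zero    (Fin.suc j) eq = contradiction eq (All.lookup x∉ (∈-lookup j))
    lookup-inj (x∉ ∷ _)  (Fin.suc i) Fin.zero    eq = contradiction (sym eq) (All.lookup x∉ (∈-lookup i))
    lookup-inj (_  ∷ un) (Fin.suc i) (Fin.suc j) eq = cong Fin.suc (lookup-inj un i j eq)

    length-bound : ∀ {xs : List P̂} → Unique xs → length xs ℕ.≤ length elements-P̂
    length-bound {xs} un = Finₚ.injective⇒≤ {f = f} inj
      where
      f : Fin (length xs) → Fin (length elements-P̂)
      f i = index (complete-P̂ (lookup xs i))
      inj : ∀ {i j} → f i ≡ f j → i ≡ j
      inj {i} {j} eq = lookup-inj un i j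
        (trans (Anyₚ.lookup-index (complete-P̂ (lookup xs i)))
          (trans (cong (lookup elements-P̂) eq) (sym (Anyₚ.lookup-index (complete-P̂ (lookup xs j))))))

    start-unique : ∀ {s s′ t t′ p} → IsPath s t p → IsPath s′ t′ p → s ≡ s′
    start-unique stop       stop       = refl
    start-unique stop       (step _ _) = refl
    start-unique (step _ _) stop       = refl
    start-unique (step _ _) (step _ _) = refl

    pathsUpTo-unique : ∀ n s t → Unique (pathsUpTo n s t)
    pathsUpTo-unique zero    s t = []
    pathsUpTo-unique (suc n) s t = Uniqueₚ.++⁺ trivial
      (Uniqueₚ.map⁺ ∷-injectiveʳ
        (Uniqueₚ.concat⁺
          (Allₚ.map⁺ (All.universal (λ u → pathsUpTo-unique n u t) (lowerCovers s)))
          (AllPairsₚ.map⁺ (AllPairs.map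
            (λ u≢u′ {_} (p∈ , p∈′) → u≢u′ (start-unique (∈-pathsUpTo⁻ n p∈) (∈-pathsUpTo⁻ n p∈′)))
            (Uniqueₚ.filter⁺ (_⋖? s) unique-P̂)))))
      disjoint
      where
      trivial : Unique (if does (s ≟̂ t) then [ [ t ] ] else [])
      trivial with s ≟̂ t
      ... | yes _ = [] ∷ []
      ... | no  _ = []
      disjoint : ∀ {p} →
        ¬ (p ∈ (if does (s ≟̂ t) then [ [ t ] ] else []) ×
           p ∈ map (s ∷_) (concatMap (λ u → pathsUpTo n u t) (lowerCovers s)))
      disjoint (p∈ , q∈) with s ≟̂ t | ∈-map⁻ (s ∷_) q∈
      disjoint (here refl , q∈) | yes _ | [] , r , refl
        with _ , _ , r′ ← find (∈-concatMap⁻ (λ u → pathsUpTo n u t) {xs = lowerCovers s} r)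
        with () ← ∈-pathsUpTo⁻ n r′
  
  ∈-paths : ∀ {s t p} → p ∈ paths s t ⇔ IsPath s t p
  ∈-paths = mk⇔ (∈-pathsUpTo⁻ (length elements-P̂))
    (λ path → ∈-pathsUpTo⁺ (length elements-P̂) (length-bound (path-unique path)) path)

  paths-unique : ∀ s t → Unique (paths s t)
  paths-unique = pathsUpTo-unique (length elements-P̂)

record LinearExtension (P : FinitePoset) : Set where
  open FinitePoset P
  field
    list     : List Carrier
    complete : ∀ v → v ∈ list
    unique   : Unique list
    monotone : ∀ i j → lookup list i < lookup list j → i Fin.< j

------------------------------------------------------------------------
-- Birational rowmotion

module Rowmotion {c r} (K : Ring c r) (P : FinitePoset) where
  open Ring K using (_≈_; _+_; _*_; 0#; 1#) renaming (Carrier to 𝕂)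
  open AlgebraDefinitions _≈_ using () renaming (Invertible to InvertibleWrt)
  open Extended P

  𝕂⊥ : Set (c ⊔ lsuc (c ⊔ r))
  𝕂⊥ = Partial (c ⊔ r) 𝕂

  -- Both sides are defined and they agree.  The inverse extracted from
  -- an invertibility witness is unique up to _≈_, so the values do not
  -- depend on the witnesses chosen.
  infix 4 _≐_
  _≐_ : 𝕂⊥ → 𝕂⊥ → Set (c ⊔ r)
  x ≐ y = Σ[ dx ∈ Defined x ] Σ[ dy ∈ Defined y ] value x dx ≈ value y dy

  Invertible : 𝕂 → Set (c ⊔ r)
  Invertible = InvertibleWrt 1# _*_

  inv : 𝕂 → 𝕂⊥
  inv x = record { Defined = Invertible x ; value = proj₁ }

  sum product : List 𝕂 → 𝕂
  sum     = foldr _+_ 0#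
  product = foldr _*_ 1#

  Labeling : Set c
  Labeling = P̂ → 𝕂

  _[_≔_] : Labeling → FinitePoset.Carrier P → 𝕂 → Labeling
  (f [ v ≔ x ]) w = if does (w ≟̂ ⟦ v ⟧) then x else f w

  -- Σ_{u ⋖ v} f(u)
  lowerSum : Labeling → P̂ → 𝕂
  lowerSum f v = sum (map f (lowerCovers v))

  -- (Σ_{u ⋗ v} f(u)⁻¹)⁻¹
  upperParallelSum : Labeling → P̂ → 𝕂⊥
  upperParallelSum f v = mapPartial (inv ∘ f) (upperCovers v) >>= λ ys → inv (sum ys)

  toggle : FinitePoset.Carrier P → Labeling → Partial (c ⊔ r) Labeling
  toggle v f = do
    y ← inv (f ⟦ v ⟧)
    z ← upperParallelSum f ⟦ v ⟧
    pure (f [ v ≔ lowerSum f ⟦ v ⟧ * y * z ])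

  rowmotion : LinearExtension P → Labeling → Partial (c ⊔ r) Labeling
  rowmotion L = foldr _∘ₚ_ pure (map toggle (LinearExtension.list L))

  downSlack upSlack : Labeling → P̂ → 𝕂⊥

  downSlack g ⊥±     = pure 1#
  downSlack g ⊤±     = pure 1#
  downSlack g ⟦ v ⟧ = do
    y ← inv (lowerSum g ⟦ v ⟧)
    pure (g ⟦ v ⟧ * y)

  upSlack g ⊥±     = pure 1#
  upSlack g ⊤±     = pure 1#
  upSlack g ⟦ v ⟧ = do
    z ← upperParallelSum g ⟦ v ⟧
    y ← inv (g ⟦ v ⟧)
    pure (z * y)

  pathSum : (P̂ → 𝕂⊥) → P̂ → P̂ → 𝕂⊥
  pathSum slack s t = mapPartial pathProduct (paths s t) >>= λ ys → pure (sum ys)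
    where
    pathProduct : List P̂ → 𝕂⊥
    pathProduct p = mapPartial slack p >>= λ xs → pure (product xs)

  -- A L f ℓ s t and V L f ℓ s t are A_ℓ^{s→t} and V_ℓ^{s→t}, with R
  -- computed along the linear extension L.
  A V : LinearExtension P → Labeling → ℕ → P̂ → P̂ → 𝕂⊥
  A L f ℓ s t = iterate (rowmotion L) ℓ f >>= λ g → pathSum (downSlack g) s t
  V L f ℓ s t = iterate (rowmotion L) ℓ f >>= λ g → pathSum (upSlack g) s t

------------------------------------------------------------------------
-- Rectangles

-- Fin p stands for {1,…,p} with i : Fin p standing for toℕ i + 1.
rectangle : ℕ → ℕ → FinitePoset
rectangle p q = record
  { Carrier           = Fin p × Fin q
  ; _≤_               = Pointwise Fin._≤_ Fin._≤_
  ; isDecPartialOrder = record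
    { isPartialOrder = record
      { isPreorder = record
        { isEquivalence = isEquivalence
        ; reflexive     = λ { refl → ℕₚ.≤-refl , ℕₚ.≤-refl }
        ; trans         = λ (a , b) (a′ , b′) → ℕₚ.≤-trans a a′ , ℕₚ.≤-trans b b′
        }
      ; antisym = λ (a , b) (a′ , b′) → cong₂ _,_ (Finₚ.≤-antisym a a′) (Finₚ.≤-antisym b b′)
      }
    ; _≟_  = ≡-dec Finₚ._≟_ Finₚ._≟_
    ; _≤?_ = λ (i , j) (i′ , j′) → (i Finₚ.≤? i′) ×-dec (j Finₚ.≤? j′)
    }
  ; elements = cartesianProduct (allFin p) (allFin q)
  ; complete = λ (i , j) → ∈-cartesianProduct⁺ (∈-allFin i) (∈-allFin j)
  ; unique   = Uniqueₚ.cartesianProduct⁺ (Uniqueₚ.allFin⁺ p) (Uniqueₚ.allFin⁺ q)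
  }

{-# OPTIONS --safe #-}

-- Both path sums are compared with sums over paths from u to d′ that go down
-- along covers except for a single jump x ▷ y, which drops one rank without
-- decreasing the second coordinate.  Such a path is weighted by the down-slacks
-- before the jump, by x y⁻¹ at the jump (`J`), and by the up-slacks after it.  The
-- total weight does not depend on the position of the jump (`commute`).  A jump
-- into d′ can only start at d, and A^d = d d′⁻¹; a jump out of u can only end at
-- u′, and V^u′ = u u′⁻¹.  The slacks are defined because rowmotion is defined
-- both at the labeling and at its predecessor.

module Submission where

open import Defs
open import Algebra.Bundles using (Ring)
import Algebra.Properties.CommutativeSemigroup as CommutativeSemigroupₚ
import Algebra.Properties.Monoid as Monoidₚ
open import Data.Bool.Base using (Bool; true; false; if_then_else_)
open import Data.Fin.Base as Fin using (Fin; zero; suc; toℕ; fromℕ; fromℕ<; inject₁)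
import Data.Fin.Properties as Finₚ
open import Data.List.Base
  using (List; []; _∷_; _++_; map; foldr; filter; concatMap; lookup; length)
open import Data.List.Membership.Propositional using (_∈_)
open import Data.List.Membership.Propositional.Properties using (∈-filter⁻; ∈-filter⁺)
open import Data.List.Membership.Propositional.Properties.WithK using (unique∧set⇒bag)
open import Data.List.Properties using (map-cong-local)
open import Data.List.Relation.Binary.BagAndSetEquality using (∼bag⇒↭)
open import Data.List.Relation.Binary.Permutation.Propositional as ↭ using (_↭_)
open import Data.List.Relation.Unary.All as All using (All; []; _∷_)
open import Data.List.Relation.Unary.AllPairs as AllPairs using (AllPairs; []; _∷_)
open import Data.List.Relation.Unary.Any using (here; there; index)
import Data.List.Relation.Unary.Any.Properties as Anyₚ
open import Data.List.Relation.Unary.Unique.Propositional using (Unique)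
import Data.List.Relation.Unary.Unique.Propositional.Properties as Uniqueₚ
open import Data.Nat.Base as ℕ using (ℕ; zero; suc)
import Data.Nat.Properties as ℕₚ
open import Data.Product.Base using (Σ-syntax; _×_; _,_; proj₁; proj₂)
open import Data.Sum.Base using (_⊎_; inj₁; inj₂)
open import Data.Unit.Polymorphic.Base using (tt)
open import Function.Base using (_∘_; case_of_)
open import Function.Bundles using (mk⇔)
open import Level using (Level; _⊔_)
open import Relation.Binary.Core using (Rel)
open import Relation.Binary.Definitions using (Decidable)
import Relation.Binary.Construct.Add.Extrema.NonStrict as AddExtrema
import Relation.Binary.Construct.Add.Supremum.NonStrict as AddSupremum
open import Relation.Binary.PropositionalEquality as ≡ using (_≡_; _≢_)
import Relation.Binary.Reasoning.Setoid as SetoidReasoning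
open import Relation.Binary.Structures using (IsDecPartialOrder)
open import Relation.Nullary.Construct.Add.Extrema using (⊥±; ⊤±; [_]; [_]-injective)
open import Relation.Nullary.Decidable using (Dec; does; yes; no; dec-true; dec-false; _×-dec_)
open import Relation.Nullary.Negation using (¬_; contradiction)
open import Relation.Unary using (Pred) renaming (Decidable to Decidable₁)

-- Finite sums over lists in a noncommutative ring.

module ListSums {c r} (K : Ring c r) where
  open Ring K renaming (Carrier to 𝕂)
  open SetoidReasoning setoid
  private
    variable
      a b p : Level
      X : Set a
      Y : Set b

  infixr 5 ∑
  infix 10 [_]·_

  -- The Iverson bracket. It turns a sum over a filtered list into a sum over the whole list, where
  -- the order of summation can be exchanged.
  [_]·_ : Bool → 𝕂 → 𝕂
  [ b ]· k = if b then k else 0#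

  []·-true : ∀ {Q : Set p} {k} (Q? : Dec Q) → Q → [ does Q? ]· k ≈ k
  []·-true Q? q = reflexive (≡.cong ([_]· _) (dec-true Q? q))

  []·-false : ∀ {Q : Set p} {k} (Q? : Dec Q) → ¬ Q → [ does Q? ]· k ≈ 0#
  []·-false Q? ¬q = reflexive (≡.cong ([_]· _) (dec-false Q? ¬q))

  ∑ : List X → (X → 𝕂) → 𝕂
  ∑ xs F = foldr _+_ 0# (map F xs)

  syntax ∑ xs (λ i → e) = ∑[ i ∈ xs ] e

  ∑-cong-∈ : (xs : List X) {F G : X → 𝕂} → (∀ {i} → i ∈ xs → F i ≈ G i) → ∑ xs F ≈ ∑ xs G
  ∑-cong-∈ []       _  = refl
  ∑-cong-∈ (_ ∷ xs) eq = +-cong (eq (here ≡.refl)) (∑-cong-∈ xs (eq ∘ there))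

  ∑-cong : (xs : List X) {F G : X → 𝕂} → (∀ i → F i ≈ G i) → ∑ xs F ≈ ∑ xs G
  ∑-cong xs eq = ∑-cong-∈ xs λ {i} _ → eq i

  ∑-zero : (xs : List X) → ∑[ i ∈ xs ] 0# ≈ 0#
  ∑-zero []       = refl
  ∑-zero (_ ∷ xs) = trans (+-identityˡ _) (∑-zero xs)

  ∑-zero-∈ : (xs : List X) {F : X → 𝕂} → (∀ {i} → i ∈ xs → F i ≈ 0#) → ∑ xs F ≈ 0#
  ∑-zero-∈ xs eq = trans (∑-cong-∈ xs eq) (∑-zero xs)

  ∑-distribˡ : (xs : List X) {F : X → 𝕂} (k : 𝕂) → k * ∑ xs F ≈ ∑[ i ∈ xs ] (k * F i)
  ∑-distribˡ []       k = zeroʳ k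
  ∑-distribˡ (_ ∷ xs) k = trans (distribˡ k _ _) (+-congˡ (∑-distribˡ xs k))

  ∑-distribʳ : (xs : List X) {F : X → 𝕂} (k : 𝕂) → ∑ xs F * k ≈ ∑[ i ∈ xs ] (F i * k)
  ∑-distribʳ []       k = zeroˡ k
  ∑-distribʳ (_ ∷ xs) k = trans (distribʳ k _ _) (+-congˡ (∑-distribʳ xs k))

  ∑-distrib-+ : (xs : List X) {F G : X → 𝕂} → ∑[ i ∈ xs ] (F i + G i) ≈ ∑ xs F + ∑ xs G
  ∑-distrib-+ []       = sym (+-identityˡ 0#)
  ∑-distrib-+ (_ ∷ xs) = trans (+-congˡ (∑-distrib-+ xs)) (interchange _ _ _ _)
    where open CommutativeSemigroupₚ +-commutativeSemigroup using (interchange)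

  ∑-swap : (xs : List X) (ys : List Y) {F : X → Y → 𝕂} →
           ∑[ i ∈ xs ] ∑[ j ∈ ys ] F i j ≈ ∑[ j ∈ ys ] ∑[ i ∈ xs ] F i j
  ∑-swap []       ys = sym (∑-zero ys)
  ∑-swap (_ ∷ xs) ys = trans (+-congˡ (∑-swap xs ys)) (sym (∑-distrib-+ ys))

  ∑-++ : (xs {ys} : List X) {F : X → 𝕂} → ∑ (xs ++ ys) F ≈ ∑ xs F + ∑ ys F
  ∑-++ []       = sym (+-identityˡ _)
  ∑-++ (_ ∷ xs) = trans (+-congˡ (∑-++ xs)) (sym (+-assoc _ _ _))

  ∑-map : (h : X → Y) (xs : List X) {F : Y → 𝕂} → ∑ (map h xs) F ≈ ∑[ i ∈ xs ] F (h i)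
  ∑-map h []       = refl
  ∑-map h (_ ∷ xs) = +-congˡ (∑-map h xs)

  ∑-concatMap : (h : X → List Y) (xs : List X) {F : Y → 𝕂} →
                ∑ (concatMap h xs) F ≈ ∑[ i ∈ xs ] ∑ (h i) F
  ∑-concatMap h []       = refl
  ∑-concatMap h (x ∷ xs) = trans (∑-++ (h x)) (+-congˡ (∑-concatMap h xs))

  ∑-filter : {Q : Pred X p} (Q? : Decidable₁ Q) (xs : List X) {F : X → 𝕂} →
             ∑ (filter Q? xs) F ≈ ∑[ i ∈ xs ] [ does (Q? i) ]· F i
  ∑-filter Q? []       = refl
  ∑-filter Q? (x ∷ xs) with does (Q? x)
  ... | true  = +-congˡ (∑-filter Q? xs)
  ... | false = trans (∑-filter Q? xs) (sym (+-identityˡ _))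

  ∑-single : {xs : List X} {i : X} {F : X → 𝕂} → Unique xs → i ∈ xs →
             (∀ {j} → j ≢ i → F j ≈ 0#) → ∑ xs F ≈ F i
  ∑-single {xs = _ ∷ xs} (i∉ ∷ _) (here ≡.refl) off =
    trans (+-congˡ (∑-zero-∈ xs λ j∈ → off λ { ≡.refl → All.lookup i∉ j∈ ≡.refl })) (+-identityʳ _)
  ∑-single (j∉ ∷ un) (there i∈) off =
    trans (+-cong (off (All.lookup j∉ i∈)) (∑-single un i∈ off)) (+-identityˡ _)

  ∑-↭ : {xs ys : List X} {F : X → 𝕂} → xs ↭ ys → ∑ xs F ≈ ∑ ys F
  ∑-↭ ↭.refl          = refl
  ∑-↭ (↭.prep x p)    = +-congˡ (∑-↭ p)
  ∑-↭ (↭.swap x y p)  = trans (+-congˡ (+-congˡ (∑-↭ p))) (x∙yz≈y∙xz _ _ _)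
    where open CommutativeSemigroupₚ +-commutativeSemigroup using (x∙yz≈y∙xz)
  ∑-↭ (↭.trans p q)   = trans (∑-↭ p) (∑-↭ q)

-- Linear extensions as ordered lists.

lookup-allPairs : ∀ {a ℓ} {A : Set a} {R : Rel A ℓ} (xs : List A) →
                  (∀ i j → i Fin.< j → R (lookup xs i) (lookup xs j)) → AllPairs R xs
lookup-allPairs []       _ = []
lookup-allPairs {R = R} (x ∷ xs) h =
  All.tabulate (λ y∈ → ≡.subst (R x) (≡.sym (Anyₚ.lookup-index y∈))
    (h zero (suc (index y∈)) (ℕ.s≤s ℕ.z≤n))) ∷
  lookup-allPairs xs (λ i j i<j → h (suc i) (suc j) (ℕ.s≤s i<j))

module _ {P : FinitePoset} (L : LinearExtension P) where
  open FinitePoset P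
  private
    module L = LinearExtension L

  -- `¬ y ≤ x` packs distinctness and order into one relation, so that the induction in
  -- `toggles-toggled` needs a single invariant.
  linearExtension-order : AllPairs (λ x y → ¬ y ≤ x) L.list
  linearExtension-order = AllPairs.zipWith
    (λ (x≢y , y≮x) y≤x → y≮x (y≤x , x≢y ∘ ≡.sym))
    ( L.unique
    , lookup-allPairs {R = λ x y → ¬ y < x} L.list
        (λ i j i<j yj<yi → ℕₚ.<-asym i<j (L.monotone j i yj<yi))
    )

-- Rowmotion described by simultaneous equations between old and new labels.

module Toggles {c r} (K : Ring c r) (P : FinitePoset) where
  open Ring K using (_*_)
  open Rowmotion K P
  open Extended P
  private
    module P = FinitePoset P
    module P≤ = IsDecPartialOrder P.isDecPartialOrder

  lowerCovers⇒⋖ : ∀ {u v} → u ∈ lowerCovers v → u ⋖ v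
  lowerCovers⇒⋖ {v = v} = proj₂ ∘ ∈-filter⁻ (_⋖? v) {xs = elements-P̂}

  upperCovers⇒⋖ : ∀ {u v} → u ∈ upperCovers v → v ⋖ u
  upperCovers⇒⋖ {v = v} = proj₂ ∘ ∈-filter⁻ (v ⋖?_) {xs = elements-P̂}

  update-self : ∀ f v x → (f [ v ≔ x ]) [ v ] ≡ x
  update-self f v x = ≡.cong (if_then x else f [ v ]) (dec-true ([ v ] ≟̂ [ v ]) ≡.refl)

  update-other : ∀ f v x {w} → w ≢ [ v ] → (f [ v ≔ x ]) w ≡ f w
  update-other f v x {w} w≢v = ≡.cong (if_then x else f w) (dec-false (w ≟̂ [ v ]) w≢v)

  -- The outcome x of toggling v when rowmotion turns h into h′: the covers
  -- above v already carry their new labels, those below still the old ones.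
  record Toggled (h h′ : Labeling) (v : P.Carrier) (x : Ring.Carrier K) : Set (c ⊔ r) where
    field
      invertible : Invertible (h [ v ])
      upper      : Defined (upperParallelSum h′ [ v ])
      equation   : x ≡ lowerSum h [ v ] * proj₁ invertible * value (upperParallelSum h′ [ v ]) upper

  -- Propositional equality suffices because a toggle copies the labels that it does not change.
  -- Transport along it keeps the very same inverse, which lets `equation` in `Toggled` be
  -- propositional too.
  Invertible-resp : ∀ {x y} → x ≡ y → (I : Invertible x) → Σ[ J ∈ Invertible y ] proj₁ I ≡ proj₁ J
  Invertible-resp ≡.refl I = I , ≡.refl

  mapInv-resp : ∀ {h h′ : Labeling} us → (∀ {u} → u ∈ us → h u ≡ h′ u) →
                (D : Defined (mapPartial (inv ∘ h) us)) →
                Σ[ E ∈ Defined (mapPartial (inv ∘ h′) us) ]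
                  value (mapPartial (inv ∘ h) us) D ≡ value (mapPartial (inv ∘ h′) us) E
  mapInv-resp []       _  []       = [] , ≡.refl
  mapInv-resp (u ∷ us) eq (I ∷ Is)
    with J , p ← Invertible-resp (eq (here ≡.refl)) I
       | Js , q ← mapInv-resp us (eq ∘ there) Is
    = J ∷ Js , ≡.cong₂ _∷_ p q

  upperParallelSum-resp : ∀ {h h′ v} → (∀ {u} → v ⋖ u → h u ≡ h′ u) →
                          (D : Defined (upperParallelSum h v)) →
                          Σ[ E ∈ Defined (upperParallelSum h′ v) ]
                            value (upperParallelSum h v) D ≡ value (upperParallelSum h′ v) E
  upperParallelSum-resp {v = v} eq (Is , J)
    with Is′ , p ← mapInv-resp (upperCovers v) (eq ∘ upperCovers⇒⋖) Is
    with J′ , q ← Invertible-resp (≡.cong sum p) J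
    = (Is′ , J′) , q

  lowerSum-resp : ∀ {h h′ v} → (∀ {u} → u ⋖ v → h u ≡ h′ u) → lowerSum h v ≡ lowerSum h′ v
  lowerSum-resp {v = v} eq =
    ≡.cong sum (map-cong-local (All.tabulate (eq ∘ lowerCovers⇒⋖)))

  Toggled-resp : ∀ {h h′ k k′ v x y} → h [ v ] ≡ k [ v ] →
                 (∀ {u} → u ⋖ [ v ] → h u ≡ k u) → (∀ {u} → [ v ] ⋖ u → h′ u ≡ k′ u) →
                 x ≡ y → Toggled h h′ v x → Toggled k k′ v y
  Toggled-resp at below above ≡.refl t
    with I , p ← Invertible-resp at (Toggled.invertible t)
       | D , q ← upperParallelSum-resp above (Toggled.upper t)
    = record
    { invertible = I
    ; upper      = D
    ; equation   = ≡.trans (Toggled.equation t)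
                     (≡.cong₂ _*_ (≡.cong₂ _*_ (lowerSum-resp below) p) q)
    }

  toggles : List P.Carrier → Labeling → Partial (c ⊔ r) Labeling
  toggles vs = foldr _∘ₚ_ pure (map toggle vs)

  toggles-other : ∀ vs {h} (D : Defined (toggles vs h)) {w} → (∀ {v} → v ∈ vs → w ≢ [ v ]) →
                  value (toggles vs h) D w ≡ h w
  toggles-other []       D       off = ≡.refl
  toggles-other (v ∷ vs) {h} (D , _) off =
    ≡.trans (update-other (value (toggles vs h) D) v _ (off (here ≡.refl)))
      (toggles-other vs D (off ∘ there))

  ⋖⇒≤ : ∀ {v w} → [ v ] ⋖ [ w ] → v P.≤ w
  ⋖⇒≤ ((v≤w , _) , _) = AddExtrema.[≤]-injective P._≤_ v≤w

  -- The head `v` of the list is toggled last. By the order, neither `v` nor a lower cover of `v`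
  -- occurs in the tail, so these still carry their old labels at that moment, and toggling `v`
  -- changes nothing above it. For an entry `w` of the tail, the final toggle at `v` disturbs
  -- neither `w` nor its upper covers, because `w ≤ v` is excluded.
  toggles-toggled : ∀ vs {h} → AllPairs (λ x y → ¬ y P.≤ x) vs → (D : Defined (toggles vs h)) →
                    ∀ {v} → v ∈ vs →
                    Toggled h (value (toggles vs h) D) v (value (toggles vs h) D [ v ])
  toggles-toggled (v ∷ vs) {h} (v≱ ∷ _) (D , I , E , _) (here ≡.refl) =
    Toggled-resp
      (toggles-other vs D λ { v∈ ≡.refl → All.lookup v≱ v∈ P≤.refl })
      (λ u⋖v → toggles-other vs D λ { u∈ ≡.refl → All.lookup v≱ u∈ (⋖⇒≤ u⋖v) })
      (λ v⋖u → ≡.sym (update-other (value (toggles vs h) D) v _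
        λ { ≡.refl → proj₂ (proj₁ v⋖u) ≡.refl }))
      (≡.sym (update-self (value (toggles vs h) D) v _))
      (record { invertible = I ; upper = E ; equation = ≡.refl })
  toggles-toggled (v ∷ vs) {h} (v≱ ∷ ps) (D , _) {w} (there w∈) =
    Toggled-resp
      ≡.refl
      (λ _ → ≡.refl)
      (λ w⋖u → ≡.sym (update-other (value (toggles vs h) D) v _
        λ { ≡.refl → All.lookup v≱ w∈ (⋖⇒≤ w⋖u) }))
      (≡.sym (update-other (value (toggles vs h) D) v _ λ { ≡.refl → All.lookup v≱ w∈ P≤.refl }))
      (toggles-toggled vs ps D w∈)

  rowmotion-toggled : ∀ L {h} (D : Defined (rowmotion L h)) v →
                      Toggled h (value (rowmotion L h) D) v (value (rowmotion L h) D [ v ])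
  rowmotion-toggled L D v =
    toggles-toggled (LinearExtension.list L) (linearExtension-order L) D
      (LinearExtension.complete L v)

  -- No toggle acts at `⊥±`. This carries the invertibility of `f ⊥±` over to the iterates.
  iterate-⊥ : ∀ L ℓ {f} (D : Defined (iterate (rowmotion L) ℓ f)) →
              value (iterate (rowmotion L) ℓ f) D ⊥± ≡ f ⊥±
  iterate-⊥ L zero    D       = ≡.refl
  iterate-⊥ L (suc ℓ) (D , E) =
    ≡.trans (toggles-other (LinearExtension.list L) E λ _ ()) (iterate-⊥ L ℓ D)

-- Path sums of everywhere defined weights.

module PathSums {c r} (K : Ring c r) (P : FinitePoset) where
  open Ring K renaming (Carrier to 𝕂)
  open Rowmotion K P hiding (A; V)
  open Extended P
  open ListSums K
  open SetoidReasoning setoid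

  infix 4 _⇓_

  _⇓_ : 𝕂⊥ → 𝕂 → Set (c ⊔ r)
  x ⇓ k = Σ[ D ∈ Defined x ] value x D ≡ k

  mapPartial-total : ∀ {X : Set} {F : X → 𝕂⊥} {w} → (∀ x → F x ⇓ w x) → ∀ xs →
                     Σ[ D ∈ Defined (mapPartial F xs) ] value (mapPartial F xs) D ≡ map w xs
  mapPartial-total _ []       = [] , ≡.refl
  mapPartial-total evals (x ∷ xs) =
    let D , p = evals x ; Ds , q = mapPartial-total evals xs in D ∷ Ds , ≡.cong₂ _∷_ p q

  foldPartial-total : ∀ {X : Set} {F : X → 𝕂⊥} {w} (h : List 𝕂 → 𝕂) → (∀ x → F x ⇓ w x) → ∀ xs →
                      (mapPartial F xs >>= λ ys → pure (h ys)) ⇓ h (map w xs)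
  foldPartial-total h evals xs = let Ds , p = mapPartial-total evals xs in (Ds , tt) , ≡.cong h p

  -- The vertex bound stays a parameter because the later arguments on path sums are inductions on
  -- it.
  pathSumUpTo : ℕ → (P̂ → 𝕂) → P̂ → P̂ → 𝕂
  pathSumUpTo n w s t = ∑[ p ∈ pathsUpTo n s t ] product (map w p)

  -- Once all slacks are defined, domains of definition can be left behind and the computation takes
  -- place in the ring.
  pathSum-total : ∀ {slack w} → (∀ v → slack v ⇓ w v) → ∀ s t →
                  pathSum slack s t ⇓ pathSumUpTo (length elements-P̂) w s t
  pathSum-total evals s t = foldPartial-total sum (foldPartial-total product evals) (paths s t)

  pathSumUpTo-suc : ∀ n w s t → pathSumUpTo (suc n) w s t ≈
                    [ does (s ≟̂ t) ]· w t + w s * (∑[ u ∈ lowerCovers s ] pathSumUpTo n w u t)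
  pathSumUpTo-suc n w s t = trans (∑-++ stay) (+-cong trivial (begin
    ∑ (map (s ∷_) ps) (product ∘ map w)                 ≈⟨ ∑-map (s ∷_) ps ⟩
    ∑[ p ∈ ps ] w s * product (map w p)                 ≈⟨ ∑-distribˡ ps (w s) ⟨
    w s * (∑[ p ∈ ps ] product (map w p))               ≈⟨ *-congˡ (∑-concatMap _ (lowerCovers s)) ⟩
    w s * (∑[ u ∈ lowerCovers s ] pathSumUpTo n w u t)  ∎))
    where
    stay ps : List (List P̂)
    stay = if does (s ≟̂ t) then (t ∷ []) ∷ [] else []
    ps   = concatMap (λ u → pathsUpTo n u t) (lowerCovers s)
    trivial : ∑ stay (product ∘ map w) ≈ [ does (s ≟̂ t) ]· w t
    trivial with does (s ≟̂ t)
    ... | true  = trans (+-identityʳ _) (*-identityʳ _)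
    ... | false = refl

  -- Both lists of covers filter `elements-P̂` by the same test `u ⋖? v`, so each side is the sum
  -- over all pairs with that test as a bracket.
  ∑-covers-swap : (F : P̂ → P̂ → 𝕂) →
                  ∑[ v ∈ elements-P̂ ] ∑[ u ∈ lowerCovers v ] F u v ≈
                  ∑[ u ∈ elements-P̂ ] ∑[ v ∈ upperCovers u ] F u v
  ∑-covers-swap F = begin
    ∑[ v ∈ E ] ∑[ u ∈ lowerCovers v ] F u v            ≈⟨ ∑-cong E (λ v → ∑-filter (_⋖? v) E) ⟩
    ∑[ v ∈ E ] ∑[ u ∈ E ] [ does (u ⋖? v) ]· F u v     ≈⟨ ∑-swap E E ⟩
    ∑[ u ∈ E ] ∑[ v ∈ E ] [ does (u ⋖? v) ]· F u v     ≈⟨ ∑-cong E (λ u → ∑-filter (u ⋖?_) E) ⟨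
    ∑[ u ∈ E ] ∑[ v ∈ upperCovers u ] F u v            ∎
    where
    E : List P̂
    E = elements-P̂

-- Covering relations in the rectangle.

filter-↭ : ∀ {a p} {A : Set a} {Q : Pred A p} (Q? : Decidable₁ Q) {xs us : List A} →
           Unique xs → (∀ x → x ∈ xs) → Unique us → All Q us → (∀ {x} → Q x → x ∈ us) →
           filter Q? xs ↭ us
filter-↭ Q? {xs} xs! ∈xs us! Qus ∈us = ∼bag⇒↭ (unique∧set⇒bag (Uniqueₚ.filter⁺ Q? xs!) us!
  (mk⇔ (∈us ∘ proj₂ ∘ ∈-filter⁻ Q? {xs = xs}) (λ x∈ → ∈-filter⁺ Q? (∈xs _) (All.lookup Qus x∈))))

module RectangleCovers (m n : ℕ) where
  P : FinitePoset
  P = rectangle (suc m) (suc n)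
  open FinitePoset P using (Carrier; _≤_)
  open Extended P

  -- Duplicate-free lists with the same members are permutations of each other. Hence the covers can
  -- be given explicitly, whatever the order in which `filter` finds them.
  lowerCovers-↭ : ∀ {v us} → Unique us → All (_⋖ v) us → (∀ {u} → u ⋖ v → u ∈ us) →
                  lowerCovers v ↭ us
  lowerCovers-↭ {v} = filter-↭ (_⋖? v) unique-P̂ complete-P̂

  upperCovers-↭ : ∀ {v us} → Unique us → All (v ⋖_) us → (∀ {u} → v ⋖ u → u ∈ us) →
                  upperCovers v ↭ us
  upperCovers-↭ {v} = filter-↭ (v ⋖?_) unique-P̂ complete-P̂

  ⋖-between : ∀ {u v w} → u ⋖ v → u <̂ w → w ≤̂ v → w ≡ v
  ⋖-between {v = v} {w} (_ , ¬between) u<w w≤v with w ≟̂ v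
  ... | yes w≡v = w≡v
  ... | no  w≢v = contradiction (w , u<w , w≤v , w≢v) ¬between

  ⋖⊥ : ∀ {u} → ¬ u ⋖ ⊥±
  ⋖⊥ {⊥±} ((_ , u≢⊥) , _) = u≢⊥ ≡.refl
  ⋖⊥ {[ _ ]} ((AddSupremum.[ () ] , _) , _)

  ⊤⋖ : ∀ {v} → ¬ ⊤± ⋖ v
  ⊤⋖ {⊤±} ((_ , ⊤≢v) , _) = ⊤≢v ≡.refl

  ≤̂-intro : ∀ {v w} → v ≤ w → [ v ] ≤̂ [ w ]
  ≤̂-intro v≤w = AddExtrema.[ v≤w ]

  <̂-intro : ∀ {v w} → v ≤ w → v ≢ w → [ v ] <̂ [ w ]
  <̂-intro v≤w v≢w = ≤̂-intro v≤w , λ { ≡.refl → v≢w ≡.refl }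

  ⊥<̂ : ∀ {v} → ⊥± <̂ [ v ]
  ⊥<̂ = AddExtrema.⊥±≤[ _ ] , λ ()

  rank : Carrier → ℕ
  rank (i , j) = toℕ i ℕ.+ toℕ j

  -- If the first coordinates differ, raising that of the lower element by one gives an element
  -- strictly above it and still at most the upper one, hence equal to the upper one. Otherwise the
  -- second coordinate is raised in the same way.
  ⋖-coords : ∀ {i j i′ j′} → [ i , j ] ⋖ [ i′ , j′ ] →
             (suc (toℕ i) ≡ toℕ i′ × j ≡ j′) ⊎ (i ≡ i′ × suc (toℕ j) ≡ toℕ j′)
  ⋖-coords {i} {j} {i′} {j′} cov@((AddExtrema.[ i≤i′ , j≤j′ ] , ≢) , _)
    with i Finₚ.≟ i′ | j Finₚ.≟ j′
  ... | yes ≡.refl | yes ≡.refl = contradiction ≡.refl ≢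
  ... | no i≢i′ | _ = inj₁ (lemma (⋖-between cov
          (<̂-intro (ℕₚ.<⇒≤ i<e , ℕₚ.≤-refl) λ eq → ℕₚ.<-irrefl (≡.cong (toℕ ∘ proj₁) eq) i<e)
          (≤̂-intro (ℕₚ.≤-trans (ℕₚ.≤-reflexive e≡) i<i′ , j≤j′))))
    where
    i<i′ : toℕ i ℕ.< toℕ i′
    i<i′ = Finₚ.≤∧≢⇒< i≤i′ i≢i′
    e< : suc (toℕ i) ℕ.< suc m
    e< = ℕₚ.≤-<-trans i<i′ (Finₚ.toℕ<n i′)
    e : Fin (suc m)
    e = fromℕ< e<
    e≡ : toℕ e ≡ suc (toℕ i)
    e≡ = Finₚ.toℕ-fromℕ< e<
    i<e : toℕ i ℕ.< toℕ e
    i<e = ℕₚ.≤-reflexive (≡.sym e≡)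
    lemma : [ e , j ] ≡ [ i′ , j′ ] → suc (toℕ i) ≡ toℕ i′ × j ≡ j′
    lemma eq = ≡.trans (≡.sym e≡) (≡.cong (toℕ ∘ proj₁) ([_]-injective eq)) ,
               ≡.cong proj₂ ([_]-injective eq)
  ... | yes i≡i′ | no j≢j′ = inj₂ (i≡i′ , lemma (⋖-between cov
          (<̂-intro (ℕₚ.≤-refl , ℕₚ.<⇒≤ j<e) λ eq → ℕₚ.<-irrefl (≡.cong (toℕ ∘ proj₂) eq) j<e)
          (≤̂-intro (i≤i′ , ℕₚ.≤-trans (ℕₚ.≤-reflexive e≡) j<j′))))
    where
    j<j′ : toℕ j ℕ.< toℕ j′
    j<j′ = Finₚ.≤∧≢⇒< j≤j′ j≢j′
    e< : suc (toℕ j) ℕ.< suc n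
    e< = ℕₚ.≤-<-trans j<j′ (Finₚ.toℕ<n j′)
    e : Fin (suc n)
    e = fromℕ< e<
    e≡ : toℕ e ≡ suc (toℕ j)
    e≡ = Finₚ.toℕ-fromℕ< e<
    j<e : toℕ j ℕ.< toℕ e
    j<e = ℕₚ.≤-reflexive (≡.sym e≡)
    lemma : [ i , e ] ≡ [ i′ , j′ ] → suc (toℕ j) ≡ toℕ j′
    lemma eq = ≡.trans (≡.sym e≡) (≡.cong (toℕ ∘ proj₂) ([_]-injective eq))

  <̂⇒rank< : ∀ {v w} → [ v ] <̂ [ w ] → rank v ℕ.< rank w
  <̂⇒rank< {i , j} {i′ , j′} (AddExtrema.[ i≤i′ , j≤j′ ] , ≢)
    with ℕₚ.m≤n⇒m<n∨m≡n i≤i′ | ℕₚ.m≤n⇒m<n∨m≡n j≤j′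
  ... | inj₁ i<i′ | _ = ℕₚ.+-mono-<-≤ i<i′ j≤j′
  ... | inj₂ _ | inj₁ j<j′ = ℕₚ.+-mono-≤-< i≤i′ j<j′
  ... | inj₂ p | inj₂ q =
    contradiction (≡.cong₂ (λ i j → [ i , j ]) (Finₚ.toℕ-injective p) (Finₚ.toℕ-injective q)) ≢

  -- The rank is strictly monotone, so no element fits between comparable elements of consecutive
  -- ranks.
  ⋖-intro : ∀ {v w} → v ≤ w → suc (rank v) ≡ rank w → [ v ] ⋖ [ w ]
  ⋖-intro {v} {w} v≤w eq =
    <̂-intro v≤w (λ v≡w → ℕₚ.1+n≢n (≡.trans eq (≡.cong rank (≡.sym v≡w)))) , between
    where
    between : ¬ (Σ[ u ∈ P̂ ] [ v ] <̂ u × u <̂ [ w ])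
    between (⊥± , (AddSupremum.[ () ] , _) , _)
    between ([ u ] , v<u , u<w) = ℕₚ.<-irrefl eq (ℕₚ.≤-<-trans (<̂⇒rank< v<u) (<̂⇒rank< u<w))

  ⋖⇒rank : ∀ {v w} → [ v ] ⋖ [ w ] → suc (rank v) ≡ rank w
  ⋖⇒rank {i , j} {i′ , j′} v⋖w with ⋖-coords v⋖w
  ... | inj₁ (p , ≡.refl) = ≡.cong (ℕ._+ toℕ j) p
  ... | inj₂ (≡.refl , q) = ≡.trans (≡.sym (ℕₚ.+-suc (toℕ i) (toℕ j))) (≡.cong (toℕ i ℕ.+_) q)

  ⋖-right : ∀ {i j} {i′ : Fin (suc m)} → suc (toℕ i) ≡ toℕ i′ → [ i , j ] ⋖ [ i′ , j ]
  ⋖-right eq = ⋖-intro (ℕₚ.<⇒≤ (ℕₚ.≤-reflexive eq) , ℕₚ.≤-refl) (≡.cong (ℕ._+ _) eq)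

  ⋖-up : ∀ {i j} {j′ : Fin (suc n)} → suc (toℕ j) ≡ toℕ j′ → [ i , j ] ⋖ [ i , j′ ]
  ⋖-up {i} eq = ⋖-intro (ℕₚ.≤-refl , ℕₚ.<⇒≤ (ℕₚ.≤-reflexive eq))
    (≡.trans (≡.sym (ℕₚ.+-suc (toℕ i) _)) (≡.cong (toℕ i ℕ.+_) eq))

  -- The element `[ i , j ]` lies strictly in between. In `¬⋖⊤` the same is true of `[ i′ , j ]`.
  ¬⊥⋖ : ∀ {i i′ j} → i Fin.< i′ → ¬ ⊥± ⋖ [ i′ , j ]
  ¬⊥⋖ i<i′ ⊥⋖ with ≡.refl ← ⋖-between ⊥⋖ ⊥<̂ (≤̂-intro (ℕₚ.<⇒≤ i<i′ , ℕₚ.≤-refl)) =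
    ℕₚ.<-irrefl ≡.refl i<i′

  ¬⋖⊤ : ∀ {i i′ j} → i Fin.< i′ → ¬ [ i , j ] ⋖ ⊤±
  ¬⋖⊤ {i′ = i′} {j} i<i′ ⋖⊤
    with () ← ⋖-between {w = [ i′ , j ]} ⋖⊤
                (<̂-intro (ℕₚ.<⇒≤ i<i′ , ℕₚ.≤-refl) λ { ≡.refl → ℕₚ.<-irrefl ≡.refl i<i′ })
                AddExtrema.[ _ ]≤⊤±

  suc≢ : ∀ {o} {i i′ : Fin o} → suc (toℕ i) ≡ toℕ i′ → i ≢ i′
  suc≢ eq i≡i′ = ℕₚ.1+n≢n (≡.trans eq (≡.cong toℕ (≡.sym i≡i′)))

  suc-toℕ-injective : ∀ {o} {i i′ i″ : Fin o} →
                      suc (toℕ i) ≡ toℕ i″ → suc (toℕ i′) ≡ toℕ i″ → i ≡ i′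
  suc-toℕ-injective p q = Finₚ.toℕ-injective (ℕₚ.suc-injective (≡.trans p (≡.sym q)))

  toℕ-suc-injective : ∀ {o} {i i′ i″ : Fin o} →
                      suc (toℕ i) ≡ toℕ i′ → suc (toℕ i) ≡ toℕ i″ → i′ ≡ i″
  toℕ-suc-injective p q = Finₚ.toℕ-injective (≡.trans (≡.sym p) q)

  module Square {i i′ : Fin (suc m)} {j j′ : Fin (suc n)}
                (p : suc (toℕ i) ≡ toℕ i′) (q : suc (toℕ j) ≡ toℕ j′) where
    -- One list serves both as the lower covers of the top corner and as the upper covers of the
    -- bottom corner. This coincidence is what relates the down-slack of the former to the up-slack
    -- of the latter.
    middle : List P̂
    middle = [ i′ , j ] ∷ [ i , j′ ] ∷ []

    private
      middle! : Unique middle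
      middle! = ((λ eq → suc≢ p (≡.sym (≡.cong proj₁ ([_]-injective eq)))) ∷ []) ∷ [] ∷ []

    lowerCovers-square : lowerCovers [ i′ , j′ ] ↭ middle
    lowerCovers-square = lowerCovers-↭ middle! (⋖-up q ∷ ⋖-right p ∷ []) ∈middle
      where
      ∈middle : ∀ {u} → u ⋖ [ i′ , j′ ] → u ∈ middle
      ∈middle {⊥±} u⋖ = contradiction u⋖ (¬⊥⋖ (ℕₚ.≤-reflexive p))
      ∈middle {⊤±} u⋖ = contradiction u⋖ ⊤⋖
      ∈middle {[ k , l ]} u⋖ with ⋖-coords u⋖
      ... | inj₁ (p′ , ≡.refl) = there (here (≡.cong (λ k → [ k , j′ ]) (suc-toℕ-injective p′ p)))
      ... | inj₂ (≡.refl , q′) = here (≡.cong (λ l → [ i′ , l ]) (suc-toℕ-injective q′ q))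

    upperCovers-square : upperCovers [ i , j ] ↭ middle
    upperCovers-square = upperCovers-↭ middle! (⋖-right p ∷ ⋖-up q ∷ []) ∈middle
      where
      ∈middle : ∀ {u} → [ i , j ] ⋖ u → u ∈ middle
      ∈middle {⊥±} ⋖u = contradiction ⋖u ⋖⊥
      ∈middle {⊤±} ⋖u = contradiction ⋖u (¬⋖⊤ (ℕₚ.≤-reflexive p))
      ∈middle {[ k , l ]} ⋖u with ⋖-coords ⋖u
      ... | inj₁ (p′ , ≡.refl) = here (≡.cong (λ k → [ k , j ]) (toℕ-suc-injective p′ p))
      ... | inj₂ (≡.refl , q′) = there (here (≡.cong (λ l → [ i , l ]) (toℕ-suc-injective q′ q)))

  suc-inject₁ : ∀ (i : Fin m) → suc (toℕ (inject₁ i)) ≡ toℕ (suc i)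
  suc-inject₁ i = ≡.cong suc (Finₚ.toℕ-inject₁ i)

  lowerCovers-bottomRow : ∀ i → lowerCovers [ suc i , zero ] ↭ [ inject₁ i , zero ] ∷ []
  lowerCovers-bottomRow i = lowerCovers-↭ ([] ∷ []) (⋖-right (suc-inject₁ i) ∷ []) ∈single
    where
    ∈single : ∀ {u} → u ⋖ [ suc i , zero ] → u ∈ [ inject₁ i , zero ] ∷ []
    ∈single {⊥±} u⋖ = contradiction u⋖ (¬⊥⋖ {zero} (ℕ.s≤s ℕ.z≤n))
    ∈single {⊤±} u⋖ = contradiction u⋖ ⊤⋖
    ∈single {[ k , l ]} u⋖ with ⋖-coords u⋖
    ... | inj₁ (p , ≡.refl) =
      here (≡.cong (λ k → [ k , zero ]) (suc-toℕ-injective p (suc-inject₁ i)))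
    ... | inj₂ (_ , ())

  upperCovers-topRow : ∀ i → upperCovers [ inject₁ i , fromℕ n ] ↭ [ suc i , fromℕ n ] ∷ []
  upperCovers-topRow i = upperCovers-↭ ([] ∷ []) (⋖-right (suc-inject₁ i) ∷ []) ∈single
    where
    ∈single : ∀ {u} → [ inject₁ i , fromℕ n ] ⋖ u → u ∈ [ suc i , fromℕ n ] ∷ []
    ∈single {⊥±} ⋖u = contradiction ⋖u ⋖⊥
    ∈single {⊤±} ⋖u = contradiction ⋖u (¬⋖⊤ (ℕₚ.≤-reflexive (suc-inject₁ i)))
    ∈single {[ k , l ]} ⋖u with ⋖-coords ⋖u
    ... | inj₁ (p , ≡.refl) =
      here (≡.cong (λ k → [ k , fromℕ n ]) (toℕ-suc-injective p (suc-inject₁ i)))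
    ... | inj₂ (_ , q) = contradiction (Finₚ.≤fromℕ l) (ℕₚ.<⇒≱ (ℕₚ.≤-reflexive q))

  lowerCovers-min : lowerCovers [ zero , zero ] ↭ ⊥± ∷ []
  lowerCovers-min = lowerCovers-↭ ([] ∷ []) (⊥⋖min ∷ []) ∈single
    where
    ⊥⋖min : ⊥± ⋖ [ zero , zero ]
    ⊥⋖min = ⊥<̂ , between
      where
      between : ¬ (Σ[ u ∈ P̂ ] ⊥± <̂ u × u <̂ [ zero , zero ])
      between (⊥± , (_ , ⊥≢⊥) , _) = ⊥≢⊥ ≡.refl
      between ([ zero , zero ] , _ , _ , ≢) = ≢ ≡.refl
      between ([ suc _ , _ ] , _ , AddExtrema.[ () , _ ] , _)
      between ([ zero , suc _ ] , _ , AddExtrema.[ _ , () ] , _)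
    ∈single : ∀ {u} → u ⋖ [ zero , zero ] → u ∈ ⊥± ∷ []
    ∈single {⊥±} _ = here ≡.refl
    ∈single {⊤±} u⋖ = contradiction u⋖ ⊤⋖
    ∈single {[ k , l ]} u⋖ with ⋖-coords u⋖
    ... | inj₁ (() , _)
    ... | inj₂ (_ , ())

  max⋖⊤ : [ fromℕ m , fromℕ n ] ⋖ ⊤±
  max⋖⊤ = (AddExtrema.[ _ ]≤⊤± , λ ()) , between
    where
    between : ¬ (Σ[ u ∈ P̂ ] [ fromℕ m , fromℕ n ] <̂ u × u <̂ ⊤±)
    between (⊥± , (AddSupremum.[ () ] , _) , _)
    between (⊤± , _ , _ , ⊤≢⊤) = ⊤≢⊤ ≡.refl
    between ([ i , j ] , max<u , _) =
      ℕₚ.<⇒≱ (<̂⇒rank< max<u) (ℕₚ.+-mono-≤ (Finₚ.≤fromℕ i) (Finₚ.≤fromℕ j))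

-- Invertibility in a noncommutative ring.

module Inverses {c r} (K : Ring c r) (P : FinitePoset) where
  open Ring K renaming (Carrier to 𝕂)
  open Rowmotion K P using (Invertible)
  open Monoidₚ *-monoid using (cancelʳ)
  open SetoidReasoning setoid

  inverse-unique : ∀ {x} (I J : Invertible x) → proj₁ I ≈ proj₁ J
  inverse-unique {x} (y , yx≈1 , _) (z , _ , xz≈1) = begin
    y            ≈⟨ cancelʳ xz≈1 y ⟨
    y * x * z    ≈⟨ *-congʳ yx≈1 ⟩
    1# * z       ≈⟨ *-identityˡ z ⟩
    z            ∎

  Invertible-resp-≈ : ∀ {x y} → x ≈ y → Invertible x → Invertible y
  Invertible-resp-≈ x≈y (z , zx≈1 , xz≈1) =
    z , trans (*-congˡ (sym x≈y)) zx≈1 , trans (*-congʳ (sym x≈y)) xz≈1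

  Invertible-inverse : ∀ {x} (I : Invertible x) → Invertible (proj₁ I)
  Invertible-inverse {x} (_ , yx≈1 , xy≈1) = x , xy≈1 , yx≈1

  -- With `z` the inverse of `x * y`, the element `y * z` is clearly a right inverse of `x`. It is a
  -- left inverse as well: `y z x = y (z (x y)) y⁻¹ = y y⁻¹ = 1`.
  Invertible-cancelʳ : ∀ {x y} → Invertible y → Invertible (x * y) → Invertible x
  Invertible-cancelʳ {x} {y} (y⁻¹ , _ , yy⁻¹≈1) (z , zxy≈1 , xyz≈1) =
    y * z , left , trans (sym (*-assoc x y z)) xyz≈1
    where
    left : y * z * x ≈ 1#
    left = begin
      y * z * x                   ≈⟨ cancelʳ yy⁻¹≈1 (y * z * x) ⟨
      y * z * x * y * y⁻¹         ≈⟨ *-congʳ (*-assoc (y * z) x y) ⟩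
      y * z * (x * y) * y⁻¹       ≈⟨ *-congʳ (cancelʳ zxy≈1 y) ⟩
      y * y⁻¹                     ≈⟨ yy⁻¹≈1 ⟩
      1#                          ∎

-- Trading down-slacks for up-slacks.

module Conversion {c r} (K : Ring c r) (m n : ℕ) where
  open RectangleCovers m n
  open FinitePoset P using (Carrier; _≤_)
  open Extended P
  open Ring K hiding (zero) renaming (Carrier to 𝕂)
  open Rowmotion K P hiding (A; V)
  open Inverses K P
  open ListSums K
  open PathSums K P
  open Toggles K P
  open Monoidₚ *-monoid using (cancelˡ; cancelʳ)
  open SetoidReasoning setoid

  infix 4 _▷_ _▷?_

  _▷_ : Rel Carrier _
  x ▷ y = rank x ≡ suc (rank y) × toℕ (proj₂ x) ℕ.≤ toℕ (proj₂ y)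

  _▷?_ : Decidable _▷_
  x ▷? y = (rank x ℕₚ.≟ suc (rank y)) ×-dec (toℕ (proj₂ x) ℕₚ.≤? toℕ (proj₂ y))

  ▷-left : ∀ {i i′} j → suc (toℕ i) ≡ toℕ i′ → (i′ , j) ▷ (i , j)
  ▷-left j p = ≡.cong (ℕ._+ toℕ j) (≡.sym p) , ℕₚ.≤-refl

  -- What the two composites, a cover followed by a jump and a jump followed by a cover, have in
  -- common. Where it fails, both sides of `Commute` vanish.
  Straddles : Carrier → Carrier → Set
  Straddles x y = rank x ≡ suc (suc (rank y)) × toℕ (proj₂ x) ℕ.≤ suc (toℕ (proj₂ y))

  ⋖-proj₂ : ∀ {x y} → [ x ] ⋖ [ y ] → toℕ (proj₂ y) ℕ.≤ suc (toℕ (proj₂ x))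
  ⋖-proj₂ x⋖y with ⋖-coords x⋖y
  ... | inj₁ (_ , ≡.refl) = ℕₚ.n≤1+n _
  ... | inj₂ (_ , q)      = ℕₚ.≤-reflexive (≡.sym q)

  ⋗▷⇒straddles : ∀ {x y z} → [ z ] ⋖ [ x ] → z ▷ y → Straddles x y
  ⋗▷⇒straddles z⋖x (r , l) =
    ≡.trans (≡.sym (⋖⇒rank z⋖x)) (≡.cong suc r) , ℕₚ.≤-trans (⋖-proj₂ z⋖x) (ℕ.s≤s l)

  ▷⋗⇒straddles : ∀ {x y z} → x ▷ z → [ y ] ⋖ [ z ] → Straddles x y
  ▷⋗⇒straddles (r , l) y⋖z =
    ≡.trans r (≡.cong suc (≡.sym (⋖⇒rank y⋖z))) , ℕₚ.≤-trans l (⋖-proj₂ y⋖z)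

  -- The slacks enter only through equations free of division, so the argument is independent of how
  -- their inverses were obtained.
  module SlackIdentities
    (g g⁻¹ A V : P̂ → 𝕂)
    (inverseʳ : ∀ u → g u * g⁻¹ u ≈ 1#)
    (A-lower  : ∀ v → A [ v ] * lowerSum g [ v ] ≈ g [ v ])
    (V-upper  : ∀ v → ∑ (upperCovers [ v ]) g⁻¹ * V [ v ] ≈ g⁻¹ [ v ])
    where

    -- The value zero at `⊥±` and `⊤±` makes `J` total on `P̂`, so that jump targets can be summed
    -- over all of `elements-P̂`.
    J : P̂ → P̂ → 𝕂
    J [ x ] [ y ] = [ does (x ▷? y) ]· (g [ x ] * g⁻¹ [ y ])
    J _       _       = 0#

    J-▷ : ∀ {x y} → x ▷ y → J [ x ] [ y ] ≈ g [ x ] * g⁻¹ [ y ]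
    J-▷ {x} {y} x▷y = []·-true (x ▷? y) x▷y

    J-¬▷ : ∀ {x y} → ¬ x ▷ y → J [ x ] [ y ] ≈ 0#
    J-¬▷ {x} {y} ¬x▷y = []·-false (x ▷? y) ¬x▷y

    J-⊤ : ∀ x → J x ⊤± ≈ 0#
    J-⊤ ⊥±    = refl
    J-⊤ ⊤±    = refl
    J-⊤ [ _ ] = refl

    -- On the left the path steps down from `x` and then jumps to `y`; on the right it jumps out of
    -- `x` and then steps down to `y`. The vertex in between is summed over.
    Commute : Carrier → Carrier → Set r
    Commute x y =
      ∑[ z ∈ lowerCovers [ x ] ] A [ x ] * J z [ y ] ≈ ∑[ w ∈ upperCovers [ y ] ] J [ x ] w * V [ y ]

    commute-degenerate : ∀ {x y} → ¬ Straddles x y → Commute x y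
    commute-degenerate {x} {y} ¬str = trans
      (∑-zero-∈ (lowerCovers [ x ]) λ z∈ → trans (*-congˡ (lower (lowerCovers⇒⋖ z∈))) (zeroʳ _))
      (sym (∑-zero-∈ (upperCovers [ y ]) λ w∈ →
        trans (*-congʳ (upper (upperCovers⇒⋖ w∈))) (zeroˡ _)))
      where
      lower : ∀ {z} → z ⋖ [ x ] → J z [ y ] ≈ 0#
      lower {⊥±}    _   = refl
      lower {⊤±}    _   = refl
      lower {[ z ]} z⋖x = J-¬▷ (¬str ∘ ⋗▷⇒straddles z⋖x)
      upper : ∀ {w} → [ y ] ⋖ w → J [ x ] w ≈ 0#
      upper {⊥±}    _   = refl
      upper {⊤±}    _   = refl
      upper {[ w ]} y⋖w = J-¬▷ λ x▷w → ¬str (▷⋗⇒straddles x▷w y⋖w)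

    -- Here every lower cover of `x` can jump to `y`, and `x` can jump to every upper cover of `y`.
    -- The brackets disappear, and the defining equations of the slacks collapse both sides to
    -- `g [ x ] * g⁻¹ [ y ]`.
    commute-generic : ∀ {x y} → rank x ≡ suc (suc (rank y)) → toℕ (proj₂ x) ℕ.≤ toℕ (proj₂ y) →
      Commute x y
    commute-generic {x@(a , b)} {y@(c , d)} r b≤d = begin
      ∑[ z ∈ lowerCovers [ x ] ] A [ x ] * J z [ y ]
        ≈⟨ ∑-cong-∈ (lowerCovers [ x ]) (λ z∈ →
             trans (*-congˡ (lower (lowerCovers⇒⋖ z∈))) (sym (*-assoc _ _ _))) ⟩
      ∑[ z ∈ lowerCovers [ x ] ] A [ x ] * g z * g⁻¹ [ y ]     ≈⟨ ∑-distribʳ (lowerCovers [ x ]) _ ⟨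
      (∑[ z ∈ lowerCovers [ x ] ] A [ x ] * g z) * g⁻¹ [ y ]
        ≈⟨ *-congʳ (∑-distribˡ (lowerCovers [ x ]) _) ⟨
      A [ x ] * lowerSum g [ x ] * g⁻¹ [ y ]                   ≈⟨ *-congʳ (A-lower x) ⟩
      g [ x ] * g⁻¹ [ y ]                                      ≈⟨ *-congˡ (V-upper y) ⟨
      g [ x ] * (∑ (upperCovers [ y ]) g⁻¹ * V [ y ])          ≈⟨ *-assoc _ _ _ ⟨
      g [ x ] * ∑ (upperCovers [ y ]) g⁻¹ * V [ y ]
        ≈⟨ *-congʳ (∑-distribˡ (upperCovers [ y ]) _) ⟩
      (∑[ w ∈ upperCovers [ y ] ] g [ x ] * g⁻¹ w) * V [ y ]   ≈⟨ ∑-distribʳ (upperCovers [ y ]) _ ⟩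
      ∑[ w ∈ upperCovers [ y ] ] g [ x ] * g⁻¹ w * V [ y ]
        ≈⟨ ∑-cong-∈ (upperCovers [ y ]) (λ w∈ → *-congʳ (upper (upperCovers⇒⋖ w∈))) ⟨
      ∑[ w ∈ upperCovers [ y ] ] J [ x ] w * V [ y ]           ∎
      where
      -- The rank drops by two while the second coordinate does not decrease, so the first
      -- coordinate drops. This excludes `⊥±` below `x` and `⊤±` above `y`.
      c<a : toℕ c ℕ.< toℕ a
      c<a = ℕₚ.≰⇒> λ a≤c → ℕₚ.<⇒≱ (ℕₚ.m≤n⇒m≤1+n ℕₚ.≤-refl)
        (ℕₚ.≤-trans (ℕₚ.≤-reflexive (≡.sym r)) (ℕₚ.+-mono-≤ a≤c b≤d))
      lower : ∀ {z} → z ⋖ [ x ] → J z [ y ] ≈ g z * g⁻¹ [ y ]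
      lower {⊥±}    ⊥⋖x = contradiction ⊥⋖x (¬⊥⋖ c<a)
      lower {⊤±}    ⊤⋖x = contradiction ⊤⋖x ⊤⋖
      lower {[ z ]} z⋖x =
        J-▷ (ℕₚ.suc-injective (≡.trans (⋖⇒rank z⋖x) r) , ℕₚ.≤-trans (proj₂ (⋖⇒≤ z⋖x)) b≤d)
      upper : ∀ {w} → [ y ] ⋖ w → J [ x ] w ≈ g [ x ] * g⁻¹ w
      upper {⊥±}    y⋖⊥ = contradiction y⋖⊥ ⋖⊥
      upper {⊤±}    y⋖⊤ = contradiction y⋖⊤ (¬⋖⊤ c<a)
      upper {[ w ]} y⋖w =
        J-▷ (≡.trans r (≡.cong suc (⋖⇒rank y⋖w)) , ℕₚ.≤-trans b≤d (proj₂ (⋖⇒≤ y⋖w)))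

    -- The identity behind this is (z + w)⁻¹ z = w⁻¹ (z⁻¹ + w⁻¹)⁻¹.
    parallel-sum : ∀ {a v x y′ z z′ w w′} → z * z′ ≈ 1# → w * w′ ≈ 1# →
                   a * (z + w) ≈ x → (z′ + w′) * v ≈ y′ → a * (z * y′) ≈ x * w′ * v
    parallel-sum {a} {v} {x} {y′} {z} {z′} {w} {w′} zz′ ww′ eq₁ eq₂ = begin
      a * (z * y′)                    ≈⟨ *-congˡ (*-congˡ eq₂) ⟨
      a * (z * ((z′ + w′) * v))       ≈⟨ *-congˡ (*-assoc _ _ _) ⟨
      a * (z * (z′ + w′) * v)         ≈⟨ *-congˡ (*-congʳ (distribˡ _ _ _)) ⟩
      a * ((z * z′ + z * w′) * v)     ≈⟨ *-congˡ (*-congʳ (+-congʳ (trans zz′ (sym ww′)))) ⟩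
      a * ((w * w′ + z * w′) * v)     ≈⟨ *-congˡ (*-congʳ (+-comm _ _)) ⟩
      a * ((z * w′ + w * w′) * v)     ≈⟨ *-congˡ (*-congʳ (distribʳ _ _ _)) ⟨
      a * ((z + w) * w′ * v)          ≈⟨ *-assoc _ _ _ ⟨
      a * ((z + w) * w′) * v          ≈⟨ *-congʳ (*-assoc _ _ _) ⟨
      a * (z + w) * w′ * v            ≈⟨ *-congʳ (*-congʳ eq₁) ⟩
      x * w′ * v                      ∎

    -- Here `x` and `y` are opposite corners of a unit square. One term survives on each side, the
    -- one through `z` on the left and the one through `w` on the right, and `parallel-sum`
    -- identifies them.
    commute-square : ∀ {i i′ j j′} → suc (toℕ i) ≡ toℕ i′ → suc (toℕ j) ≡ toℕ j′ →
      Commute (i′ , j′) (i , j)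
    commute-square {i} {i′} {j} {j′} p q = begin
      ∑[ u ∈ lowerCovers x ] A x * J u y     ≈⟨ ∑-↭ lowerCovers-square ⟩
      A x * J z y + (A x * J w y + 0#)       ≈⟨ +-cong (*-congˡ (J-▷ (▷-left j p)))
                                                  (+-congʳ (trans (*-congˡ (J-¬▷ w¬▷y)) (zeroʳ _))) ⟩
      A x * (g z * g⁻¹ y) + (0# + 0#)        ≈⟨ trans (+-congˡ (+-identityˡ _)) (+-identityʳ _) ⟩
      A x * (g z * g⁻¹ y)                    ≈⟨ parallel-sum (inverseʳ z) (inverseʳ w) lower upper ⟩
      g x * g⁻¹ w * V y                      ≈⟨ trans (+-identityˡ _) (+-identityʳ _) ⟨
      0# + (g x * g⁻¹ w * V y + 0#)          ≈⟨ +-cong (trans (*-congʳ (J-¬▷ x¬▷z)) (zeroˡ _))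
                                                  (+-congʳ (*-congʳ (J-▷ (▷-left j′ p)))) ⟨
      J x z * V y + (J x w * V y + 0#)       ≈⟨ ∑-↭ upperCovers-square ⟨
      ∑[ u ∈ upperCovers y ] J x u * V y     ∎
      where
      open Square p q
      x y z w : P̂
      x = [ i′ , j′ ]
      y = [ i , j ]
      z = [ i′ , j ]
      w = [ i , j′ ]
      j′≰j : ¬ (toℕ j′ ℕ.≤ toℕ j)
      j′≰j = ℕₚ.<⇒≱ (ℕₚ.≤-reflexive q)
      w¬▷y : ¬ (i , j′) ▷ (i , j)
      w¬▷y = j′≰j ∘ proj₂
      x¬▷z : ¬ (i′ , j′) ▷ (i′ , j)
      x¬▷z = j′≰j ∘ proj₂
      lower : A x * (g z + g w) ≈ g x
      lower = begin
        A x * (g z + g w)          ≈⟨ *-congˡ (+-congˡ (+-identityʳ _)) ⟨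
        A x * (g z + (g w + 0#))   ≈⟨ *-congˡ (∑-↭ lowerCovers-square) ⟨
        A x * lowerSum g x         ≈⟨ A-lower _ ⟩
        g x                        ∎
      upper : (g⁻¹ z + g⁻¹ w) * V y ≈ g⁻¹ y
      upper = begin
        (g⁻¹ z + g⁻¹ w) * V y          ≈⟨ *-congʳ (+-congˡ (+-identityʳ _)) ⟨
        (g⁻¹ z + (g⁻¹ w + 0#)) * V y   ≈⟨ *-congʳ (∑-↭ upperCovers-square) ⟨
        ∑ (upperCovers y) g⁻¹ * V y    ≈⟨ V-upper _ ⟩
        g⁻¹ y                          ∎

    commute : ∀ x y → Commute x y
    commute x@(a , b) y@(c , d)
      with rank x ℕₚ.≟ suc (suc (rank y)) | toℕ b ℕₚ.≤? toℕ d | toℕ b ℕₚ.≟ suc (toℕ d)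
    ... | no r≢ | _       | _     = commute-degenerate {x} {y} (r≢ ∘ proj₁)
    ... | yes r | yes b≤d | _     = commute-generic {x} {y} r b≤d
    -- The second coordinate accounts for one of the two ranks, which leaves exactly one for the
    -- first.
    ... | yes r | no _    | yes q =
      commute-square (≡.sym (ℕₚ.+-cancelʳ-≡ (suc (toℕ d)) (toℕ a) (suc (toℕ c)) a+)) (≡.sym q)
      where
      a+ : toℕ a ℕ.+ suc (toℕ d) ≡ suc (toℕ c) ℕ.+ suc (toℕ d)
      a+ = ≡.trans (≡.cong (toℕ a ℕ.+_) (≡.sym q))
             (≡.trans r (≡.cong suc (≡.sym (ℕₚ.+-suc (toℕ c) (toℕ d)))))
    ... | yes _ | no b≰d  | no q≢ =
      commute-degenerate {x} {y} λ (_ , l) → q≢ (ℕₚ.≤-antisym l (ℕₚ.≰⇒> b≰d))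

    -- Moving the jump along whole paths.

    module _ (i : Fin m) where
      d d′ : P̂
      d  = [ suc i , zero ]
      d′ = [ inject₁ i , zero ]

      -- The V-weighted sum over the paths from y to d′ with at most n vertices,
      -- with the first vertex omitted from the weight.
      tailSum : ℕ → P̂ → 𝕂
      tailSum zero    y = 0#
      tailSum (suc n) y = [ does (y ≟̂ d′) ]· 1# + (∑[ z ∈ lowerCovers y ] V z * tailSum n z)

      pathSumUpTo-⊥ : ∀ n w v → pathSumUpTo n w ⊥± [ v ] ≈ 0#
      pathSumUpTo-⊥ zero    w v = refl
      pathSumUpTo-⊥ (suc n) w v = begin
        pathSumUpTo (suc n) w ⊥± [ v ]                          ≈⟨ pathSumUpTo-suc n w ⊥± [ v ] ⟩
        0# + w ⊥± * (∑[ u ∈ LC ] pathSumUpTo n w u [ v ])       ≈⟨ +-identityˡ _ ⟩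
        w ⊥± * (∑[ u ∈ LC ] pathSumUpTo n w u [ v ])            ≈⟨ *-congˡ (∑-zero-∈ LC noCover) ⟩
        w ⊥± * 0#                                               ≈⟨ zeroʳ _ ⟩
        0#                                                      ∎
        where
        LC : List P̂
        LC = lowerCovers ⊥±
        noCover : ∀ {u} → u ∈ LC → pathSumUpTo n w u [ v ] ≈ 0#
        noCover u∈ = contradiction (lowerCovers⇒⋖ u∈) ⋖⊥

      tailSum-⊥ : ∀ n → tailSum n ⊥± ≈ 0#
      tailSum-⊥ zero    = refl
      tailSum-⊥ (suc n) = trans (+-identityˡ _)
        (∑-zero-∈ (lowerCovers ⊥±) λ u∈ → contradiction (lowerCovers⇒⋖ u∈) ⋖⊥)

      pathSumUpTo-tailSum : ∀ n y → pathSumUpTo n V y d′ ≈ V y * tailSum n y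
      pathSumUpTo-tailSum zero    y = sym (zeroʳ _)
      pathSumUpTo-tailSum (suc n) y = begin
        pathSumUpTo (suc n) V y d′
          ≈⟨ pathSumUpTo-suc n V y d′ ⟩
        [ does (y ≟̂ d′) ]· V d′ + V y * (∑[ z ∈ lowerCovers y ] pathSumUpTo n V z d′)
          ≈⟨ +-cong first (*-congˡ (∑-cong (lowerCovers y) (pathSumUpTo-tailSum n))) ⟩
        V y * [ does (y ≟̂ d′) ]· 1# + V y * (∑[ z ∈ lowerCovers y ] V z * tailSum n z)
          ≈⟨ distribˡ _ _ _ ⟨
        V y * tailSum (suc n) y ∎
        where
        first : [ does (y ≟̂ d′) ]· V d′ ≈ V y * [ does (y ≟̂ d′) ]· 1#
        first with y ≟̂ d′
        ... | yes ≡.refl = sym (*-identityʳ _)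
        ... | no  _      = sym (zeroʳ _)

      -- `d′` is the only lower cover of `d`, so the sum below `d` is a single label.
      A-d : A d ≈ g d * g⁻¹ d′
      A-d = begin
        A d                              ≈⟨ cancelʳ (inverseʳ d′) _ ⟨
        A d * g d′ * g⁻¹ d′              ≈⟨ *-congʳ (*-congˡ (+-identityʳ _)) ⟨
        A d * (g d′ + 0#) * g⁻¹ d′       ≈⟨ *-congʳ (*-congˡ (∑-↭ (lowerCovers-bottomRow i))) ⟨
        A d * lowerSum g d * g⁻¹ d′      ≈⟨ *-congʳ (A-lower _) ⟩
        g d * g⁻¹ d′                     ∎

      -- A jump does not decrease the second coordinate, so a jump into the bottom row starts there,
      -- and the rank leaves only `d`.
      J-d′ : ∀ x → [ does ([ x ] ≟̂ d) ]· A d ≈ J [ x ] d′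
      J-d′ x = case [ x ] ≟̂ d of λ
        { (yes x≡d@≡.refl) → trans ([]·-true ([ x ] ≟̂ d) x≡d)
                               (trans A-d (sym (J-▷ (▷-left zero (suc-inject₁ i)))))
        ; (no x≢d)         → trans ([]·-false ([ x ] ≟̂ d) x≢d)
                               (sym (J-¬▷ {x} {inject₁ i , zero} (x≢d ∘ ▷d′ x)))
        }
        where
        ▷d′ : ∀ x → x ▷ (inject₁ i , zero) → [ x ] ≡ d
        ▷d′ (k , zero) (r , _) = ≡.cong (λ k → [ k , zero ]) (Finₚ.toℕ-injective
          (≡.trans (ℕₚ.+-cancelʳ-≡ 0 (toℕ k) _ r) (suc-inject₁ i)))

      -- Induction on `n`. A path stopping at `d` becomes a jump to `d′` with trivial tail. For a
      -- longer path the induction hypothesis places the jump at the second vertex, and `commute`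
      -- pulls it back to the first. The top is excluded because paths leave it but jumps do not.
      pathSum-jump : ∀ n s → s ≢ ⊤± →
        pathSumUpTo n A s d ≈ ∑[ y ∈ elements-P̂ ] J s y * tailSum n y
      pathSum-jump n ⊥± _ = trans (pathSumUpTo-⊥ n A _)
        (sym (∑-zero-∈ elements-P̂ λ _ → zeroˡ _))
      pathSum-jump n       ⊤±    ⊤≢⊤ = contradiction ≡.refl ⊤≢⊤
      pathSum-jump zero    [ x ] _   = sym (∑-zero-∈ elements-P̂ λ _ → zeroʳ _)
      pathSum-jump (suc n) [ x ] _   = begin
        pathSumUpTo (suc n) A s d
          ≈⟨ pathSumUpTo-suc n A s d ⟩
        [ does (s ≟̂ d) ]· A d + A s * (∑[ z ∈ lowerCovers s ] pathSumUpTo n A z d)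
          ≈⟨ +-cong stopping moving ⟩
        (∑[ y ∈ E ] J s y * [ does (y ≟̂ d′) ]· 1#) +
        (∑[ y ∈ E ] J s y * (∑[ u ∈ lowerCovers y ] V u * tailSum n u))
          ≈⟨ ∑-distrib-+ E ⟨
        ∑[ y ∈ E ] (J s y * [ does (y ≟̂ d′) ]· 1# + J s y * (∑[ u ∈ lowerCovers y ] V u * tailSum n u))
          ≈⟨ ∑-cong E (λ y → distribˡ _ _ _) ⟨
        ∑[ y ∈ E ] J s y * tailSum (suc n) y ∎
        where
        s : P̂
        s = [ x ]
        E : List P̂
        E = elements-P̂

        stopping : [ does (s ≟̂ d) ]· A d ≈ ∑[ y ∈ E ] J s y * [ does (y ≟̂ d′) ]· 1#
        stopping = begin
          [ does (s ≟̂ d) ]· A d                     ≈⟨ J-d′ x ⟩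
          J s d′                                     ≈⟨ *-identityʳ _ ⟨
          J s d′ * 1#                                ≈⟨ *-congˡ ([]·-true (d′ ≟̂ d′) ≡.refl) ⟨
          J s d′ * [ does (d′ ≟̂ d′) ]· 1#           ≈⟨ ∑-single unique-P̂ (complete-P̂ d′) off ⟨
          ∑[ y ∈ E ] J s y * [ does (y ≟̂ d′) ]· 1#  ∎
          where
          off : ∀ {y} → y ≢ d′ → J s y * [ does (y ≟̂ d′) ]· 1# ≈ 0#
          off {y} y≢d′ = trans (*-congˡ ([]·-false (y ≟̂ d′) y≢d′)) (zeroʳ _)

        exchange : ∀ y → (∑[ z ∈ lowerCovers s ] A s * J z y) * tailSum n y ≈
                         (∑[ w ∈ upperCovers y ] J s w * V y) * tailSum n y
        exchange [ y ] = *-congʳ (commute x y)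
        -- `commute` says nothing here, but no path from `⊥±` reaches `d′`, so the tail factor
        -- vanishes.
        exchange ⊥±    = trans (vanish _) (sym (vanish _))
          where
          vanish : ∀ e → e * tailSum n ⊥± ≈ 0#
          vanish e = trans (*-congˡ (tailSum-⊥ n)) (zeroʳ e)
        exchange ⊤±    = *-congʳ (trans
          (∑-zero-∈ (lowerCovers s) λ {z} _ → trans (*-congˡ (J-⊤ z)) (zeroʳ _))
          (sym (∑-zero-∈ (upperCovers ⊤±) λ w∈ → contradiction (upperCovers⇒⋖ w∈) ⊤⋖)))

        moving : A s * (∑[ z ∈ lowerCovers s ] pathSumUpTo n A z d) ≈
                 ∑[ y ∈ E ] J s y * (∑[ u ∈ lowerCovers y ] V u * tailSum n u)
        moving = begin
          A s * (∑[ z ∈ lowerCovers s ] pathSumUpTo n A z d)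
            ≈⟨ *-congˡ (∑-cong-∈ (lowerCovers s) λ z∈ →
                 pathSum-jump n _ λ { ≡.refl → ⊤⋖ (lowerCovers⇒⋖ {v = s} z∈) }) ⟩
          A s * (∑[ z ∈ lowerCovers s ] ∑[ y ∈ E ] J z y * tailSum n y)
            ≈⟨ ∑-distribˡ (lowerCovers s) _ ⟩
          ∑[ z ∈ lowerCovers s ] A s * (∑[ y ∈ E ] J z y * tailSum n y)
            ≈⟨ ∑-cong (lowerCovers s) (λ z →
                 trans (∑-distribˡ E _) (∑-cong E λ y → sym (*-assoc _ _ _))) ⟩
          ∑[ z ∈ lowerCovers s ] ∑[ y ∈ E ] A s * J z y * tailSum n y
            ≈⟨ ∑-swap (lowerCovers s) E ⟩
          ∑[ y ∈ E ] ∑[ z ∈ lowerCovers s ] A s * J z y * tailSum n y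
            ≈⟨ ∑-cong E (λ y → ∑-distribʳ (lowerCovers s) _) ⟨
          ∑[ y ∈ E ] (∑[ z ∈ lowerCovers s ] A s * J z y) * tailSum n y
            ≈⟨ ∑-cong E exchange ⟩
          ∑[ y ∈ E ] (∑[ w ∈ upperCovers y ] J s w * V y) * tailSum n y
            ≈⟨ ∑-cong E (λ y →
                 trans (∑-distribʳ (upperCovers y) _) (∑-cong (upperCovers y) λ w → *-assoc _ _ _)) ⟩
          ∑[ y ∈ E ] ∑[ w ∈ upperCovers y ] J s w * (V y * tailSum n y)
            -- The jump target becomes the outer variable and the former `y` its lower cover `u`,
            -- which is the shape of the recursion for `tailSum`.
            ≈⟨ ∑-covers-swap (λ u v → J s v * (V u * tailSum n u)) ⟨
          ∑[ y ∈ E ] ∑[ u ∈ lowerCovers y ] J s y * (V u * tailSum n u)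
            ≈⟨ ∑-cong E (λ y → ∑-distribˡ (lowerCovers y) _) ⟨
          ∑[ y ∈ E ] J s y * (∑[ u ∈ lowerCovers y ] V u * tailSum n u) ∎

      module _ (k : Fin m) where
        u u′ : P̂
        u  = [ suc k , fromℕ n ]
        u′ = [ inject₁ k , fromℕ n ]

        V-u′ : V u′ ≈ g u * g⁻¹ u′
        V-u′ = begin
          V u′                                       ≈⟨ cancelˡ (inverseʳ u) _ ⟨
          g u * (g⁻¹ u * V u′)                       ≈⟨ *-congˡ (*-congʳ (+-identityʳ _)) ⟨
          g u * ((g⁻¹ u + 0#) * V u′)                ≈⟨ *-congˡ (*-congʳ (∑-↭ (upperCovers-topRow k))) ⟨
          g u * (∑ (upperCovers u′) g⁻¹ * V u′)      ≈⟨ *-congˡ (V-upper _) ⟩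
          g u * g⁻¹ u′                               ∎

        -- A jump out of the top row must stay in it, and then the rank determines its target.
        J-u : ∀ y → y ≢ u′ → J u y ≈ 0#
        J-u ⊥±    _ = refl
        J-u ⊤±    _ = refl
        J-u [ y ] y≢u′ = J-¬▷ {suc k , fromℕ n} {y} (y≢u′ ∘ u▷ y)
          where
          u▷ : ∀ y → (suc k , fromℕ n) ▷ y → [ y ] ≡ u′
          u▷ (c , e) (r , top≤e)
            with ≡.refl ← Finₚ.≤-antisym {i = e} {j = fromℕ n} (Finₚ.≤fromℕ e) top≤e =
            ≡.cong (λ c → [ c , fromℕ n ]) (suc-toℕ-injective
              (≡.sym (ℕₚ.+-cancelʳ-≡ (toℕ (fromℕ n)) _ (suc (toℕ c)) r)) (suc-inject₁ k))

        -- With the jump at the first vertex, only the target `u′` contributes. The jump weight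
        -- equals the up-slack of `u′`, which is precisely the factor that `tailSum` omits.
        conversion : ∀ N → pathSumUpTo N A u d ≈ pathSumUpTo N V u′ d′
        conversion N = begin
          pathSumUpTo N A u d                          ≈⟨ pathSum-jump N u (λ ()) ⟩
          ∑[ y ∈ elements-P̂ ] J u y * tailSum N y     ≈⟨ ∑-single unique-P̂ (complete-P̂ u′) off ⟩
          J u u′ * tailSum N u′                        ≈⟨ *-congʳ (J-▷ (▷-left (fromℕ n) (suc-inject₁ k))) ⟩
          g u * g⁻¹ u′ * tailSum N u′                  ≈⟨ *-congʳ V-u′ ⟨
          V u′ * tailSum N u′                          ≈⟨ pathSumUpTo-tailSum N u′ ⟨
          pathSumUpTo N V u′ d′                        ∎
          where
          off : ∀ {y} → y ≢ u′ → J u y * tailSum N y ≈ 0#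
          off {y} y≢u′ = trans (*-congʳ (J-u y y≢u′)) (zeroˡ _)

  -- Definedness of the slacks.

  record Regular (g : Labeling) : Set (c ⊔ r) where
    field
      invertible : ∀ u → Invertible (g u)
      lower      : ∀ v → Invertible (lowerSum g [ v ])
      upper      : ∀ v → Defined (upperParallelSum g [ v ])

  -- `g` is the new labeling for `D` and the old one for `E`. The step `D` inverted the labels of
  -- `g` above each element and their sums of inverses; the step `E` inverts the label of `g` at
  -- each element of the rectangle.
  rowmotion-regular : ∀ L {h} (D : Defined (rowmotion L h)) →
    let g = value (rowmotion L h) D in
    Invertible (g ⊥±) → Defined (rowmotion L g) → Regular g
  rowmotion-regular L {h} D I⊥ E = record
    { invertible = invertible
    ; lower      = lower
    ; upper      = upper
    }
    where
    g g′ : Labeling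
    g  = value (rowmotion L h) D
    g′ = value (rowmotion L g) E

    max : Carrier
    max = fromℕ m , fromℕ n

    upper : ∀ v → Defined (upperParallelSum g [ v ])
    upper v = Toggled.upper (rowmotion-toggled L D v)

    module T v = Toggled (rowmotion-toggled L E v)

    upper⇒invertible : ∀ {k u v} → Defined (upperParallelSum k v) → v ⋖ u → Invertible (k u)
    upper⇒invertible {v = v} (Is , _) v⋖u = All.lookup Is (∈-filter⁺ (v ⋖?_) (complete-P̂ _) v⋖u)

    invertible : ∀ u → Invertible (g u)
    invertible ⊥±    = I⊥
    -- The toggle at the maximal element inverts the label of `⊤±`.
    invertible ⊤±    = upper⇒invertible {v = [ max ]} (upper max) max⋖⊤
    invertible [ v ] = T.invertible v

    -- The toggle at `w` in the step `E` inverts `g′ [ v ]`, which is the product of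
    -- `lowerSum g [ v ]` and two inverses. Cancelling these from the right leaves the sum
    -- invertible.
    lower-⋗ : ∀ {w v} → [ w ] ⋖ [ v ] → Invertible (lowerSum g [ v ])
    lower-⋗ {w} {v} w⋖v =
      Invertible-cancelʳ (Invertible-inverse (T.invertible v))
        (Invertible-cancelʳ (Invertible-inverse (proj₂ (T.upper v)))
          (Invertible-resp-≈ (reflexive (T.equation v))
            (upper⇒invertible {v = [ w ]} (T.upper w) w⋖v)))

    lower : ∀ v → Invertible (lowerSum g [ v ])
    -- There is no `w` for `lower-⋗` at the minimum, but the sum below it is just the label at `⊥±`.
    lower (zero  , zero)  = Invertible-resp-≈ (sym (trans (∑-↭ lowerCovers-min) (+-identityʳ _))) I⊥
    lower (suc i , j)     = lower-⋗ {inject₁ i , j} (⋖-right (suc-inject₁ i))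
    lower (zero  , suc j) = lower-⋗ {zero , inject₁ j} (⋖-up (≡.cong suc (Finₚ.toℕ-inject₁ j)))

  regular⇒conversion : ∀ {g} → Regular g → ∀ k i →
    pathSum (downSlack g) [ suc k , fromℕ n ] [ suc i , zero ] ≐
    pathSum (upSlack g) [ inject₁ k , fromℕ n ] [ inject₁ i , zero ]
  regular⇒conversion {g} reg k i =
    let DA , eqA = pathSum-total {downSlack g} (λ v → down v , ≡.refl)
                     [ suc k , fromℕ n ] [ suc i , zero ]
        DV , eqV = pathSum-total {upSlack g} (λ v → up v , ≡.refl)
                     [ inject₁ k , fromℕ n ] [ inject₁ i , zero ]
    in DA , DV ,
       trans (reflexive eqA) (trans (conversion i k (length elements-P̂)) (sym (reflexive eqV)))
    where
    open Regular reg

    down : ∀ v → Defined (downSlack g v)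
    down ⊥±    = tt
    down ⊤±    = tt
    down [ v ] = lower v , tt

    up : ∀ v → Defined (upSlack g v)
    up ⊥±    = tt
    up ⊤±    = tt
    up [ v ] = upper v , invertible [ v ] , tt

    g⁻¹ : P̂ → 𝕂
    g⁻¹ u = proj₁ (invertible u)

    -- The inverses inside `upper` come from other witnesses than those of `invertible`, so they
    -- agree only up to `_≈_`.
    sum-inverses : ∀ us (Is : Defined (mapPartial (inv ∘ g) us)) →
                   ∑ us g⁻¹ ≈ sum (value (mapPartial (inv ∘ g) us) Is)
    sum-inverses []       []       = refl
    sum-inverses (u ∷ us) (I ∷ Is) = +-cong (inverse-unique (invertible u) I) (sum-inverses us Is)

    open SlackIdentities g g⁻¹
      (λ v → value (downSlack g v) (down v))
      (λ v → value (upSlack g v) (up v))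
      (λ u → proj₂ (proj₂ (invertible u)))
      (λ v → cancelʳ (proj₁ (proj₂ (lower v))) _)
      (λ v → trans (*-congʳ (sum-inverses (upperCovers [ v ]) (proj₁ (upper v))))
               (cancelˡ (proj₂ (proj₂ (proj₂ (upper v)))) _))

-- The conversion identity for iterates of rowmotion.

open import Data.Nat.Base using (_≤_)

-- The sides are p = `suc m` and q = `suc n`, which makes them positive. `Fin m` enumerates
-- {2,...,p}: an index and its predecessor are `suc k` and `inject₁ k`.
lemma9p2 :
    ∀ {c r} (K : Ring c r) (m n : ℕ) →
    let open Rowmotion K (rectangle (suc m) (suc n)) in
    (L : LinearExtension (rectangle (suc m) (suc n)))
    (f : Labeling) (k i : Fin m) →
    Invertible (f ⊥±) →
    (ℓ : ℕ) → 1 ≤ ℓ →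
    Defined (iterate (rowmotion L) (suc ℓ) f) →
    let u  = [ (suc k , fromℕ n) ]
        u′ = [ (inject₁ k , fromℕ n) ]
        d  = [ (suc i , zero) ]
        d′ = [ (inject₁ i , zero) ]
    in A L f ℓ u d ≐ V L f ℓ u′ d′
-- Since ℓ is at least 1, the labeling is itself the result of a rowmotion step, witnessed by `D′`.
-- The next step is witnessed by `E`.
lemma9p2 K m n L f k i I⊥ (suc ℓ) _ (D@(_ , D′) , E) =
  let DA , DV , eq = regular⇒conversion (rowmotion-regular L D′ I⊥′ E) k i
  in (D , DA) , (D , DV) , eq
  where
  open Conversion K m n
  open Toggles K (rectangle (suc m) (suc n))
  I⊥′ = proj₁ (Invertible-resp (≡.sym (iterate-⊥ L (suc ℓ) D)) I⊥)
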